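{- Let $q,\alpha_1,\alpha_2,\alpha_3\in\mathbb{Q}$ with $q>5$, $\alpha_1\notin[-2,0]$, $\alpha_2\in(-2,0)$ and $\alpha_3<-1$. Suppose that $T^-$ and $T^+$ satisfy $0<T^-\le T^+$. Given a target edge-weight $T^*\in[T^-,T^+]$ and a positive value $\pi$ which is sufficiently small with respect to $q,\alpha_1,\alpha_2,\alpha_3,T^-,T^+$, there is a planar graph $\Upsilon$ (depending on $T^*$ and $\pi$) and a weight function $\widehat w:E(\Upsilon)\to\{\alpha_1,\alpha_2,\alpha_3\}$ that implements a weight $w^*$ with $T^*-\pi\le w^*\le T^*$. The size of $\Upsilon$ is at most a polynomial in $\log(\pi^{ -1})$. (This upper bound on the size of $\Upsilon$ does not depend on $T^*$, though it does depend on the fixed bounds $T^-$ and $T^+$.)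
   Context: Graphs are finite and may have loops and multiple edges. The number $q$ is fixed. A planar graph $\Upsilon$ with distinct distinguished vertices $s,t$ on the outer face and weights $\widehat w:E(\Upsilon)\to\mathbb{Q}$ implements the weight $w^*$ if $Z_{s|t}(\Upsilon)\ne0$ and $w^*=qZ_{st}(\Upsilon)/Z_{s|t}(\Upsilon)$. Here $Z_{st}(\Upsilon)$ (resp. $Z_{s|t}(\Upsilon)$) is the sum of $\big(\prod_{e\in A}\widehat w(e)\big)q^{\kappa(V(\Upsilon),A)}$ over all $A\subseteq E(\Upsilon)$ such that $s,t$ are in the same component (resp. different components) of $(V(\Upsilon),A)$, and $\kappa(V(\Upsilon),A)$ is the number of connected components of $(V(\Upsilon),A)$. The polynomial in the size bound may depend on $q,\alpha_1,\alpha_2,\alpha_3,T^-,T^+$ but not on $\pi$ or $T^*$.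
   Formalization: The bounds T^- and T^+, the target edge-weight T^* and the positive value π are taken to be rational numbers rather than arbitrary reals. -}

module Defs where

open import Algebra.Definitions.RawSemiring using (product; _^_)
open import Data.Bool.Base using (Bool; true; false; not; if_then_else_)
open import Data.Fin.Base as Fin using (Fin; zero; suc)
import Data.Fin.Properties as Fin
open import Data.Fin.Subset as Subset using (Subset; inside; outside)
import Data.Fin.Subset.Properties as Subset
open import Data.Integer.Base using (∣_∣)
open import Data.List.Base as List using (List; []; _∷_; _++_; allFin; filter; foldr; length)
open import Data.List.Membership.Propositional using (_∈_)
open import Data.List.Membership.Propositional.Properties
  using (∈-allFin; ∈-filter⁺; ∈-filter⁻; ∈-map⁺; ∈-map⁻)
open import Data.List.Relation.Unary.Any using (here; there)
open import Data.Nat.Base as ℕ using (ℕ; zero; suc)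
open import Data.Nat.Logarithm using (⌈log₂_⌉)
open import Data.Product.Base using (∃; ∃-syntax; _×_; _,_; proj₁; proj₂)
open import Data.Nat.GeneralisedArithmetic using (iterate)
open import Data.Rational.Base hiding (∣_∣)
open import Data.Rational.Properties using (pos⇒nonZero)
open import Data.Sum.Base using (_⊎_; inj₁; inj₂)
open import Data.Vec.Base as Vec using ([]; _∷_)
open import Function.Base using (_∘_)
open import Function.Bundles using (_⇔_)
open import Function.Definitions using (Surjective)
open import Relation.Binary.Construct.Closure.Equivalence as EqC using (EqClosure)
open import Relation.Binary.Construct.Closure.ReflexiveTransitive using (ε; _◅_; _◅◅_)
open import Relation.Binary.Construct.Closure.Symmetric using (fwd; bwd)
open import Relation.Binary.PropositionalEquality using (_≡_; _≢_; refl)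
open import Relation.Nullary using (Dec; ¬?)
open import Relation.Nullary.Decidable as Dec using (_×-dec_; _⊎-dec_; _→-dec_)

------------------------------------------------------------------------
-- Decidability of the equivalence closure of a finite relation

Linked : ∀ {n} → List (Fin n × Fin n) → Fin n → Fin n → Set
Linked L u v = (u , v) ∈ L

private
  Via : ∀ {n} (a b : Fin n) → List (Fin n × Fin n) → Fin n → Fin n → Set
  Via a b L u v = u ~ v ⊎ (u ~ a × b ~ v) ⊎ (u ~ b × a ~ v)
    where _~_ = EqClosure (Linked L)

  split : ∀ {n} {a b : Fin n} {L u v} →
          EqClosure (Linked ((a , b) ∷ L)) u v → Via a b L u v
  split ε = inj₁ ε
  split (fwd (here refl) ◅ p) with split p
  ... | inj₁ bv              = inj₂ (inj₁ (ε , bv))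
  ... | inj₂ (inj₁ (_ , bv)) = inj₂ (inj₁ (ε , bv))
  ... | inj₂ (inj₂ (_ , av)) = inj₁ av
  split (bwd (here refl) ◅ p) with split p
  ... | inj₁ av              = inj₂ (inj₂ (ε , av))
  ... | inj₂ (inj₁ (_ , bv)) = inj₁ bv
  ... | inj₂ (inj₂ (_ , av)) = inj₂ (inj₂ (ε , av))
  split (fwd (there x) ◅ p) with split p
  ... | inj₁ r              = inj₁ (fwd x ◅ r)
  ... | inj₂ (inj₁ (r , s)) = inj₂ (inj₁ (fwd x ◅ r , s))
  ... | inj₂ (inj₂ (r , s)) = inj₂ (inj₂ (fwd x ◅ r , s))
  split (bwd (there x) ◅ p) with split p
  ... | inj₁ r              = inj₁ (bwd x ◅ r)
  ... | inj₂ (inj₁ (r , s)) = inj₂ (inj₁ (bwd x ◅ r , s))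
  ... | inj₂ (inj₂ (r , s)) = inj₂ (inj₂ (bwd x ◅ r , s))

  join : ∀ {n} {a b : Fin n} {L u v} →
         Via a b L u v → EqClosure (Linked ((a , b) ∷ L)) u v
  join (inj₁ r)              = EqC.map there r
  join (inj₂ (inj₁ (r , s))) = EqC.map there r ◅◅ fwd (here refl) ◅ EqC.map there s
  join (inj₂ (inj₂ (r , s))) = EqC.map there r ◅◅ bwd (here refl) ◅ EqC.map there s

linked? : ∀ {n} (L : List (Fin n × Fin n)) u v → Dec (EqClosure (Linked L) u v)
linked? [] u v = Dec.map′ (λ { refl → ε }) from (u Fin.≟ v)
  where
  from : ∀ {u v} → EqClosure (Linked []) u v → u ≡ v
  from ε             = refl
  from (fwd () ◅ _)
  from (bwd () ◅ _)
linked? ((a , b) ∷ L) u v = Dec.map′ join split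
  (linked? L u v ⊎-dec
    ((linked? L u a ×-dec linked? L b v) ⊎-dec (linked? L u b ×-dec linked? L a v)))

------------------------------------------------------------------------
-- Finite multigraphs, loops allowed

record Graph : Set where
  field
    #V   : ℕ
    #E   : ℕ
    ends : Fin #E → Fin #V × Fin #V   -- the order of the two ends is immaterial

  V E : Set
  V = Fin #V
  E = Fin #E

  size : ℕ
  size = #V ℕ.+ #E

  Adjacent : Subset #E → V → V → Set
  Adjacent A u v = ∃[ e ] e Subset.∈ A × ends e ≡ (u , v)

  Connected : Subset #E → V → V → Set
  Connected A = EqClosure (Adjacent A)

  connected? : ∀ A u v → Dec (Connected A u v)
  connected? A u v = Dec.map′ (EqC.map to) (EqC.map from) (linked? links u v)
    where
    links : List (V × V)
    links = List.map ends (filter (Subset._∈? A) (allFin #E))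

    to : ∀ {u v} → Linked links u v → Adjacent A u v
    to uv∈ with ∈-map⁻ ends uv∈
    ... | e , e∈ , refl = e , proj₂ (∈-filter⁻ (Subset._∈? A) {xs = allFin #E} e∈) , refl

    from : ∀ {u v} → Adjacent A u v → Linked links u v
    from (e , e∈A , refl) = ∈-map⁺ ends (∈-filter⁺ (Subset._∈? A) (∈-allFin e) e∈A)

  -- Components are counted through their least vertices.
  LeastInComponent : Subset #E → V → Set
  LeastInComponent A v = ∀ u → Connected A u v → v Fin.≤ u

  leastInComponent? : ∀ A v → Dec (LeastInComponent A v)
  leastInComponent? A v = Fin.all? λ u → connected? A u v →-dec v Fin.≤? u

  κ : Subset #E → ℕ
  κ A = length (filter (leastInComponent? A) (allFin #V))

  -- Each edge gives two darts (half-edges), one leaving each end; a loop gives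
  -- two darts leaving the same vertex.
  Dart : Set
  Dart = E × Bool

  tail : Dart → V
  tail (e , false) = proj₁ (ends e)
  tail (e , true)  = proj₂ (ends e)

  reverse : Dart → Dart
  reverse (e , b) = e , not b

  Isolated : V → Set
  Isolated v = ∀ e → proj₁ (ends e) ≢ v × proj₂ (ends e) ≢ v

  isolated? : ∀ v → Dec (Isolated v)
  isolated? v = Fin.all? λ e →
    ¬? (proj₁ (ends e) Fin.≟ v) ×-dec ¬? (proj₂ (ends e) Fin.≟ v)

  #isolated : ℕ
  #isolated = length (filter isolated? (allFin #V))

Orbit : {A : Set} → (A → A) → A → A → Set
Orbit f x y = ∃[ k ] iterate f x k ≡ y

------------------------------------------------------------------------
-- Planarity

-- Embeddings in the plane are given combinatorially, by rotation systems of
-- genus zero.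
record PlaneEmbedding (G : Graph) : Set where
  open Graph G
  field
    -- The next dart in the cyclic order around the tail.  By rotate-cyclic,
    -- rotate permutes the darts leaving each vertex in a single cycle.
    rotate        : Dart → Dart
    rotate-cyclic : ∀ d d′ → tail d ≡ tail d′ ⇔ Orbit rotate d d′

  -- The next dart along the boundary of a face.
  next : Dart → Dart
  next = rotate ∘ reverse

  field
    #walks          : ℕ
    walk            : Dart → Fin #walks
    walk-surjective : Surjective _≡_ _≡_ walk
    walk-boundary   : ∀ d d′ → walk d ≡ walk d′ ⇔ Orbit next d d′

    -- Each component satisfies V - E + F = 2 - 2g with g ≥ 0, an isolated vertex
    -- having one face although it has no dart.  Summing over the components, the
    -- equation says that g = 0 for all of them.
    euler : #V ℕ.+ (#walks ℕ.+ #isolated) ≡ #E ℕ.+ 2 ℕ.* κ Subset.⊤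

  OnBoundary : Fin #walks → V → Set
  OnBoundary f v = ∃[ d ] tail d ≡ v × walk d ≡ f

  -- Any face of an embedding in the sphere can be taken as the outer face, and
  -- this choice can be made in each component independently, the components
  -- being then drawn side by side.
  OnOuterFace : V → V → Set
  OnOuterFace s t = Connected Subset.⊤ s t → ∃[ f ] OnBoundary f s × OnBoundary f t

record TwoTerminalPlanarGraph : Set where
  field
    graph     : Graph
    s t       : Graph.V graph
    s≢t       : s ≢ t
    embedding : PlaneEmbedding graph
    outer     : PlaneEmbedding.OnOuterFace embedding s t

  open Graph graph public

------------------------------------------------------------------------
-- The random cluster (multivariate Tutte) polynomial

subsets : ∀ n → List (Subset n)
subsets zero    = [] ∷ []
subsets (suc n) = List.map (inside ∷_) (subsets n) ++ List.map (outside ∷_) (subsets n)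

infixr 8 _^ℚ_
_^ℚ_ : ℚ → ℕ → ℚ
_^ℚ_ = _^_ +-*-rawSemiring

module _ (q : ℚ) (Υ : TwoTerminalPlanarGraph) where
  open TwoTerminalPlanarGraph Υ

  term : (E → ℚ) → Subset #E → ℚ
  term ŵ A = product +-*-rawSemiring (λ e → if Vec.lookup A e then ŵ e else 1ℚ) * q ^ℚ κ A

  sumOfTerms : (E → ℚ) → List (Subset #E) → ℚ
  sumOfTerms ŵ As = foldr _+_ 0ℚ (List.map (term ŵ) As)

  Z-st Z-s∣t : (E → ℚ) → ℚ
  Z-st  ŵ = sumOfTerms ŵ (filter (λ A → connected? A s t) (subsets #E))
  Z-s∣t ŵ = sumOfTerms ŵ (filter (λ A → ¬? (connected? A s t)) (subsets #E))

  Implements : (E → ℚ) → ℚ → Set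
  Implements ŵ w* = ∃ λ (Z≢0 : Z-s∣t ŵ ≢ 0ℚ) →
    w* ≡ ((q * Z-st ŵ) ÷ Z-s∣t ŵ) {{≢-nonZero Z≢0}}

------------------------------------------------------------------------
-- Size bounds

-- The polynomial with the given coefficients, constant term first.
⟦_⟧ : List ℕ → ℕ → ℕ
⟦ p ⟧ x = foldr (λ a r → a ℕ.+ x ℕ.* r) 0 p

-- log₂ (π⁻¹) rounded up, for 0 < π ≤ 1.
⌈log₂1/_⌉ : (π : ℚ) → .{{Positive π}} → ℕ
⌈log₂1/ π ⌉ = ⌈log₂ ∣ ⌈ (1/ π) {{pos⇒nonZero π}} ⌉ ∣ ⌉

{-# OPTIONS --safe #-}

-- Two parallel edges of weight α₁ have the effective weight (1 + α₁)² − 1 > 0, so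
-- a bundle of parallel edges of weight α₁ can have an effective weight w₀ ≥ q².
-- Putting such a bundle in parallel or in series with a network of weight x gives
-- the weights
--
--   f(x) = (1 + x)(1 + w₀) − 1   and   g(x) = x w₀ / (q + x + w₀),
--
-- which map (0 , ∞) onto (w₀ , ∞) and (0 , w₀) respectively.  An interval
-- [L , U] that does not contain w₀ is therefore the image of another interval
-- under f or g.  In the coordinate x / (x + q) ∈ (0 , 1) both maps contract
-- distances by the factor w₀ / (w₀ + q) at least, so pulling [T − π , T] back
-- repeatedly must reach an interval containing w₀ within O(log π⁻¹) steps.
-- Undoing the steps gives a series-parallel network whose weight lies in
-- [T − π , T].
--
-- The network is built by doubling and subdividing edges of a single edge.  Both
-- operations are local on a rotation system, and on the partition functions they
-- amount to the usual parallel and series laws.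

module Submission where

open import Algebra.Definitions.RawSemiring using (product)
open import Algebra.Properties.Monoid.Mult using (×-assocˡ; ×-homo-+)
open import Data.Bool.Base using (Bool; true; false; not; if_then_else_; _∨_; _∧_)
open import Data.Bool.Properties using (∨-zeroʳ)
open import Data.Empty using (⊥-elim)
open import Data.Fin.Base using (Fin; zero; suc; inject₁; fromℕ; toℕ)
open import Data.Fin.Properties as Fin using (_≟_; inject₁-injective; fromℕ≢inject₁)
import Data.Fin.Relation.Unary.Top as Top
open import Data.Fin.Subset as Subset using (Subset; inside; outside)
open import Data.Integer.Base as ℤ using (ℤ; -[1+_]; ∣_∣)
import Data.Integer.DivMod as ℤ
import Data.Integer.Properties as ℤ
open import Data.List.Base as List using (List; []; _∷_; _++_; filter; foldr; length)
open import Data.List.Membership.Propositional using (_∈_)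
import Data.List.Properties as List
open import Data.List.Relation.Unary.Any using (here)
open import Data.Nat.Base as ℕ using (ℕ; zero; suc; ⌊_/2⌋; ⌈_/2⌉)
open import Data.Nat.Coprimality using (1-coprimeTo) renaming (sym to coprime-sym)
open import Data.Nat.Logarithm using (⌈log₂_⌉)
open import Data.Nat.Logarithm.Core using (⌈log2⌉)
import Data.Nat.Properties as ℕ
open import Data.Nat.Solver renaming (module +-*-Solver to ℕ-Solver)
open import Data.Product.Base using (∃-syntax; Σ-syntax; _×_; _,_; proj₁; proj₂; map₂)
open import Data.Rational.Base hiding (∣_∣)
import Data.Rational.Properties as ℚ
open import Data.Rational.Solver using (module +-*-Solver)
open import Data.Sum.Base using (_⊎_; inj₁; inj₂)
open import Data.Vec.Base using ([]; _∷_; lookup; _[_]≔_; here; there)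
open import Data.Vec.Functional as Vector using ()
open import Data.Vec.Properties using
  ([]=⇒lookup; lookup⇒[]=; lookup∘updateAt; lookup∘updateAt′; lookup-replicate; []≔-lookup; []≔-idempotent)
open import Defs
open import Function.Base using (_∘_; id; const; case_of_)
open import Function.Bundles using (_⇔_; mk⇔; Equivalence)
open import Function.Definitions using (Surjective)
open import Induction.WellFounded using (Acc; acc)
open import Relation.Binary.Construct.Closure.Equivalence as EqC using ()
open import Relation.Binary.Construct.Closure.ReflexiveTransitive using (ε; _◅_)
open import Relation.Binary.Construct.Closure.Symmetric using (fwd; bwd)
open import Relation.Binary.PropositionalEquality
open import Relation.Nullary using (Dec; does; yes; no; ¬_; ¬?; contradiction)
open import Relation.Nullary.Decidable using (does-⇔; dec-true; dec-false)
open import Relation.Unary using (Decidable)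

open +-*-Solver using (solve; _:+_; _:*_; _:-_; _:=_; con)
open ℕ-Solver using () renaming (solve to ℕ-solve; con to ℕ-con; _:+_ to _⊕_; _:*_ to _⊗_; _:=_ to _⊜_)

-- Orbits of permutations of darts

module _ {A : Set} where

  orbit-step : ∀ {f : A → A} {x y z} → f x ≡ y → Orbit f y z → Orbit f x z
  orbit-step refl (k , eq) = suc k , eq

  orbit-trans : ∀ {f : A → A} {x y z} → Orbit f x y → Orbit f y z → Orbit f x z
  orbit-trans (zero  , refl) q = q
  orbit-trans (suc k , eq)   q = orbit-step refl (orbit-trans (k , eq) q)

  orbit-cong : ∀ {f g : A → A} → f ≗ g → ∀ {x y} → Orbit f x y → Orbit g x y
  orbit-cong f≗g (zero  , eq) = zero , eq
  orbit-cong f≗g (suc k , eq) = orbit-step (sym (f≗g _)) (orbit-cong f≗g (k , eq))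

  orbit-predecessor : ∀ {f : A → A} {x y} → Orbit f (f x) y → ∃[ z ] f z ≡ y
  orbit-predecessor (zero  , eq) = _ , eq
  orbit-predecessor (suc k , eq) = orbit-predecessor (k , eq)

  Cyclic : {L : Set} → (A → A) → (A → L) → Set
  Cyclic f ℓ = ∀ x y → ℓ x ≡ ℓ y ⇔ Orbit f x y

  module _ {L : Set} {ℓ : A → L} where

    cyclic-cong : ∀ {f g} → f ≗ g → Cyclic f ℓ → Cyclic g ℓ
    cyclic-cong f≗g cyc x y = mk⇔
      (orbit-cong f≗g ∘ Equivalence.to (cyc x y))
      (Equivalence.from (cyc x y) ∘ orbit-cong (sym ∘ f≗g))

    cyclic-congʳ : ∀ {f} {ℓ′ : A → L} → ℓ ≗ ℓ′ → Cyclic f ℓ → Cyclic f ℓ′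
    cyclic-congʳ ℓ≗ℓ′ cyc x y = mk⇔
      (λ eq → Equivalence.to (cyc x y) (trans (ℓ≗ℓ′ x) (trans eq (sym (ℓ≗ℓ′ y)))))
      (λ o → trans (sym (ℓ≗ℓ′ x)) (trans (Equivalence.from (cyc x y) o) (ℓ≗ℓ′ y)))

    cyclic-invariant : ∀ {f} → Cyclic f ℓ → ∀ x → ℓ (f x) ≡ ℓ x
    cyclic-invariant cyc x = sym (Equivalence.from (cyc x _) (1 , refl))

    orbit-invariant : ∀ {f} → (∀ x → ℓ (f x) ≡ ℓ x) → ∀ {x y} → Orbit f x y → ℓ x ≡ ℓ y
    orbit-invariant inv (zero  , refl) = refl
    orbit-invariant inv (suc k , eq)   = trans (sym (inv _)) (orbit-invariant inv (k , eq))

-- Doubling an edge e and subdividing it are dual to each other: in both cases a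
-- new edge zero is added, and splice turns next (for doubling) or rotate (for
-- subdivision) into the permutation of the new darts in which (zero , true)
-- takes the place of (e , true), and (zero , false) and (e , true) form a new
-- cycle, of length two.
module Splice {m : ℕ} (e : Fin m) where

  rev : ∀ {k} → Fin k × Bool → Fin k × Bool
  rev (i , b) = i , not b

  lift : Fin m × Bool → Fin (suc m) × Bool
  lift (i , false) = suc i , false
  lift (i , true)  = if does (i ≟ e) then (zero , true) else (suc i , true)

  splice : (Fin m × Bool → Fin m × Bool) → Fin (suc m) × Bool → Fin (suc m) × Bool
  splice f (zero  , false) = suc e , true
  splice f (zero  , true)  = lift (f (e , true))
  splice f (suc i , false) = lift (f (i , false))
  splice f (suc i , true)  = if does (i ≟ e) then (zero , false) else lift (f (i , true))

  data View : Fin (suc m) × Bool → Set where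
    lifted : ∀ d → View (lift d)
    digon₀ : View (zero , false)
    digon₁ : View (suc e , true)

  view : ∀ d → View d
  view (zero  , false) = digon₀
  view (zero  , true)  with e ≟ e | lifted (e , true)
  ... | yes _ | v = v
  ... | no ¬p | _ = ⊥-elim (¬p refl)
  view (suc i , false) = lifted (i , false)
  view (suc i , true)  with i ≟ e | lifted (i , true)
  ... | yes refl | _ = digon₁
  ... | no _     | v = v

  splice-lift : ∀ f d → splice f (lift d) ≡ lift (f d)
  splice-lift f (i , false) = refl
  splice-lift f (i , true) with i ≟ e in eq
  ... | yes refl = refl
  ... | no _ rewrite eq = refl

  splice-digon₁ : ∀ f → splice f (suc e , true) ≡ (zero , false)
  splice-digon₁ f with e ≟ e
  ... | yes _ = refl
  ... | no ¬p = ⊥-elim (¬p refl)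

  module _ {n : ℕ} where

    spliceLabel : (Fin m × Bool → Fin n) → Fin (suc m) × Bool → Fin (suc n)
    spliceLabel ℓ (zero  , false) = fromℕ n
    spliceLabel ℓ (zero  , true)  = inject₁ (ℓ (e , true))
    spliceLabel ℓ (suc i , false) = inject₁ (ℓ (i , false))
    spliceLabel ℓ (suc i , true)  = if does (i ≟ e) then fromℕ n else inject₁ (ℓ (i , true))

    spliceLabel-lift : ∀ ℓ d → spliceLabel ℓ (lift d) ≡ inject₁ (ℓ d)
    spliceLabel-lift ℓ (i , false) = refl
    spliceLabel-lift ℓ (i , true) with i ≟ e in eq
    ... | yes refl = refl
    ... | no _ rewrite eq = refl

    spliceLabel-digon₁ : ∀ ℓ → spliceLabel ℓ (suc e , true) ≡ fromℕ n
    spliceLabel-digon₁ ℓ with e ≟ e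
    ... | yes _ = refl
    ... | no ¬p = ⊥-elim (¬p refl)

    splice-cyclic : ∀ {f ℓ} → Cyclic f ℓ → Cyclic (splice f) (spliceLabel ℓ)
    splice-cyclic {f} {ℓ} cyc x y = mk⇔ (complete (view x) (view y)) (orbit-invariant (invariant ∘ view))
      where
      invariant : ∀ {d} → View d → spliceLabel ℓ (splice f d) ≡ spliceLabel ℓ d
      invariant (lifted d) = trans (cong (spliceLabel ℓ) (splice-lift f d))
        (trans (spliceLabel-lift ℓ (f d))
        (trans (cong inject₁ (cyclic-invariant cyc d)) (sym (spliceLabel-lift ℓ d))))
      invariant digon₀ = spliceLabel-digon₁ ℓ
      invariant digon₁ = trans (cong (spliceLabel ℓ) (splice-digon₁ f)) (sym (spliceLabel-digon₁ ℓ))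

      lift-orbit : ∀ {d d′} → Orbit f d d′ → Orbit (splice f) (lift d) (lift d′)
      lift-orbit (zero  , refl) = zero , refl
      lift-orbit (suc k , eq)   = orbit-step (splice-lift f _) (lift-orbit (k , eq))

      separate : ∀ {A : Set} d {v} → v ≡ fromℕ n → spliceLabel ℓ (lift d) ≡ v → A
      separate d last eq = ⊥-elim (fromℕ≢inject₁ (trans (sym last) (trans (sym eq) (spliceLabel-lift ℓ d))))

      complete : ∀ {d d′} → View d → View d′ →
                 spliceLabel ℓ d ≡ spliceLabel ℓ d′ → Orbit (splice f) d d′
      complete (lifted d) (lifted d′) eq = lift-orbit (Equivalence.to (cyc d d′)
        (inject₁-injective (trans (sym (spliceLabel-lift ℓ d)) (trans eq (spliceLabel-lift ℓ d′)))))
      complete (lifted d) digon₀ eq = separate d refl eq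
      complete (lifted d) digon₁ eq = separate d (spliceLabel-digon₁ ℓ) eq
      complete digon₀ (lifted d) eq = separate d refl (sym eq)
      complete digon₁ (lifted d) eq = separate d (spliceLabel-digon₁ ℓ) (sym eq)
      complete digon₀ digon₀ _ = 0 , refl
      complete digon₀ digon₁ _ = 1 , refl
      complete digon₁ digon₀ _ = 1 , splice-digon₁ f
      complete digon₁ digon₁ _ = 0 , refl

  module _ {L : Set} where

    insertLabel : (Fin m × Bool → L) → Fin (suc m) × Bool → L
    insertLabel ℓ (zero  , b) = ℓ (e , b)
    insertLabel ℓ (suc i , b) = ℓ (i , b)

    insertLabel-lift : ∀ ℓ d → insertLabel ℓ (lift d) ≡ ℓ d
    insertLabel-lift ℓ (i , false) = refl
    insertLabel-lift ℓ (i , true) with i ≟ e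
    ... | yes refl = refl
    ... | no _     = refl

    insert-cyclic : ∀ {f ℓ} → Cyclic (f ∘ rev) ℓ → Cyclic (splice f ∘ rev) (insertLabel ℓ)
    insert-cyclic {f} {ℓ} cyc x y = mk⇔ complete (orbit-invariant invariant)
      where
      g : Fin (suc m) × Bool → Fin (suc m) × Bool
      g = splice f ∘ rev

      old : Fin m × Bool → Fin (suc m) × Bool
      old (i , b) = suc i , b

      inv : ∀ d → ℓ (f (rev d)) ≡ ℓ d
      inv = cyclic-invariant cyc

      invariant : ∀ d → insertLabel ℓ (g d) ≡ insertLabel ℓ d
      invariant (zero  , true)  = refl
      invariant (zero  , false) = trans (insertLabel-lift ℓ _) (inv (e , false))
      invariant (suc i , true)  = trans (insertLabel-lift ℓ _) (inv (i , true))
      invariant (suc i , false) with i ≟ e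
      ... | yes refl = refl
      ... | no _     = trans (insertLabel-lift ℓ _) (inv (i , false))

      lift-old : ∀ d → Orbit g (lift d) (old d)
      lift-old (i , false) = 0 , refl
      lift-old (i , true) with i ≟ e
      ... | yes refl = 1 , refl
      ... | no _     = 0 , refl

      old-lift : ∀ d → Orbit g (old d) (lift (f (rev d)))
      old-lift (i , true)  = 1 , refl
      old-lift (i , false) with i ≟ e in eq
      ... | yes refl = orbit-step g≡ (1 , refl)
        where
        g≡ : g (suc e , false) ≡ (zero , false)
        g≡ = splice-digon₁ f
      ... | no _     = 1 , g≡
        where
        g≡ : g (suc i , false) ≡ lift (f (i , true))
        g≡ rewrite eq = refl

      old-orbit : ∀ {d d′} → Orbit (f ∘ rev) d d′ → Orbit g (old d) (old d′)
      old-orbit (zero  , refl) = 0 , refl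
      old-orbit {d} (suc k , eq) =
        orbit-trans (old-lift d) (orbit-trans (lift-old _) (old-orbit (k , eq)))

      leave : ∀ d → ∃[ d′ ] insertLabel ℓ d ≡ ℓ d′ × Orbit g d (old d′)
      leave (suc i , b)     = (i , b) , refl , 0 , refl
      leave (zero  , true)  = (e , true) , refl , 1 , refl
      leave (zero  , false) = _ , sym (inv (e , false)) , orbit-step refl (lift-old _)

      reach : ∀ d → ∃[ d′ ] insertLabel ℓ d ≡ ℓ d′ × Orbit g (old d′) d
      reach (suc i , b)     = (i , b) , refl , 0 , refl
      reach (zero  , false) = (e , false) , refl , 1 , splice-digon₁ f
      reach (zero  , true)
        with orbit-predecessor (Equivalence.to (cyc _ (e , true)) (inv (e , true)))
      ... | d , eq = d , trans (cong ℓ (sym eq)) (inv d) ,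
        subst (Orbit g (old d)) (trans (cong lift eq) lift-e) (old-lift d)
        where
        lift-e : lift (e , true) ≡ (zero , true)
        lift-e with e ≟ e
        ... | yes _ = refl
        ... | no ¬p = ⊥-elim (¬p refl)

      complete : ∀ {d d′} → insertLabel ℓ d ≡ insertLabel ℓ d′ → Orbit g d d′
      complete {d} {d′} eq with leave d | reach d′
      ... | a , la , oa | b , lb , ob = orbit-trans oa
        (orbit-trans (old-orbit (Equivalence.to (cyc a b) (trans (sym la) (trans eq lb)))) ob)

-- Doubling and subdividing an edge

module _ {A B : Set} {P : A → Set} {Q : B → Set} (P? : Decidable P) (Q? : Decidable Q) where

  count-cong : ∀ {n} (f : Fin n → A) (g : Fin n → B) → (∀ i → P (f i) ⇔ Q (g i)) →
               length (filter P? (List.tabulate f)) ≡ length (filter Q? (List.tabulate g))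
  count-cong {zero} f g _ = refl
  count-cong {suc n} f g P⇔Q
    with does (P? (f zero)) | does (Q? (g zero)) | does-⇔ (P⇔Q zero) (P? (f zero)) (Q? (g zero))
  ... | true  | _ | refl = cong suc (count-cong (f ∘ suc) (g ∘ suc) (P⇔Q ∘ suc))
  ... | false | _ | refl = count-cong (f ∘ suc) (g ∘ suc) (P⇔Q ∘ suc)

module _ {A : Set} {P : A → Set} (P? : Decidable P) where

  count-last : ∀ {n} (f : Fin (suc n) → A) → length (filter P? (List.tabulate f)) ≡
               (if does (P? (f (fromℕ n))) then 1 else 0) ℕ.+
               length (filter P? (List.tabulate (f ∘ inject₁)))
  count-last {zero} f with does (P? (f zero))
  ... | true  = refl
  ... | false = refl
  count-last {suc n} f with does (P? (f zero))
  ... | true  = trans (cong suc (count-last (f ∘ suc))) (sym (ℕ.+-suc _ _))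
  ... | false = count-last (f ∘ suc)

update-∈ : ∀ {n} (A : Subset n) e {b i} → i Subset.∈ A → (i ≡ e → b ≡ true) → i Subset.∈ A [ e ]≔ b
update-∈ A e {b} {i} i∈A eq with i ≟ e
... | yes refl = lookup⇒[]= e _ (trans (lookup∘updateAt e A) (eq refl))
... | no i≢e   = lookup⇒[]= i _ (trans (lookup∘updateAt′ i e i≢e A) ([]=⇒lookup i∈A))

∈-update : ∀ {n} (A : Subset n) e {b i} → i Subset.∈ A [ e ]≔ b →
           (i ≡ e × b ≡ true) ⊎ (i ≢ e × i Subset.∈ A)
∈-update A e {b} {i} i∈ with i ≟ e
... | yes refl = inj₁ (refl , trans (sym (lookup∘updateAt e A)) ([]=⇒lookup i∈))
... | no i≢e   = inj₂ (i≢e , lookup⇒[]= i A (trans (sym (lookup∘updateAt′ i e i≢e A)) ([]=⇒lookup i∈)))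

module _ (G : Graph) (e : Graph.E G) where
  open Graph G

  double : Graph
  double = record { #V = #V ; #E = suc #E ; ends = ends e Vector.∷ ends }

  -- The edge e = {u , v} becomes {u , x}, and the new edge zero is {x , v}.  The
  -- new vertex x is numbered last so that it never is the least of a component
  -- that contains an old vertex.
  subdivide : Graph
  subdivide = record
    { #V   = suc #V
    ; #E   = suc #E
    ; ends = (fromℕ #V , inject₁ (proj₂ (ends e))) Vector.∷
             λ i → inject₁ (proj₁ (ends i)) ,
                   (if does (i ≟ e) then fromℕ #V else inject₁ (proj₂ (ends i)))
    }

  private
    module D = Graph double
    module S = Graph subdivide

    u v : V
    u = proj₁ (ends e)
    v = proj₂ (ends e)

    ∨-case : ∀ {n} b (A : Subset n) i → b ∨ lookup A i ≡ true → b ≡ true ⊎ i Subset.∈ A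
    ∨-case true  A i eq = inj₁ refl
    ∨-case false A i eq = inj₂ (lookup⇒[]= i A eq)

    subdivide-ends : ∀ {i} → i ≢ e → S.ends (suc i) ≡ (inject₁ (proj₁ (ends i)) , inject₁ (proj₂ (ends i)))
    subdivide-ends {i} i≢e with i ≟ e
    ... | yes i≡e = ⊥-elim (i≢e i≡e)
    ... | no _    = refl

    subdivide-ends-e : S.ends (suc e) ≡ (inject₁ u , fromℕ #V)
    subdivide-ends-e with e ≟ e
    ... | yes _  = refl
    ... | no e≢e = ⊥-elim (e≢e refl)

  double-connected : ∀ b A {x y} → D.Connected (b ∷ A) x y ⇔ Connected (A [ e ]≔ (b ∨ lookup A e)) x y
  double-connected b A = mk⇔ (EqC.map to) (EqC.map from)
    where
    to : ∀ {x y} → D.Adjacent (b ∷ A) x y → Adjacent (A [ e ]≔ (b ∨ lookup A e)) x y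
    to (zero  , here , eq)     = e , lookup⇒[]= e _ (lookup∘updateAt e A) , eq
    to (suc i , there i∈ , eq) = i , update-∈ A e i∈ (λ { refl → trans (cong (b ∨_) ([]=⇒lookup i∈)) (∨-zeroʳ b) }) , eq

    from : ∀ {x y} → Adjacent (A [ e ]≔ (b ∨ lookup A e)) x y → D.Adjacent (b ∷ A) x y
    from (i , i∈ , eq) with ∈-update A e i∈
    ... | inj₂ (_ , i∈A) = suc i , there i∈A , eq
    ... | inj₁ (refl , b∨) with ∨-case b A e b∨
    ...   | inj₁ refl = zero , here , eq
    ...   | inj₂ e∈A  = suc e , there e∈A , eq

  subdivide-connected : ∀ b A {x y} →
    S.Connected (b ∷ A) (inject₁ x) (inject₁ y) ⇔ Connected (A [ e ]≔ (b ∧ lookup A e)) x y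
  subdivide-connected b A {x} {y} = mk⇔
    (λ c → subst₂ (Connected _) (project-inject₁ x) (project-inject₁ y) (EqC.gfold (EqC.isEquivalence _) project to c))
    (EqC.gfold (EqC.isEquivalence _) inject₁ from)
    where
    B : Subset #E
    B = A [ e ]≔ (b ∧ lookup A e)

    -- The new vertex is projected to an old vertex it is adjacent to, if any.
    end : V
    end = if lookup A e then u else v

    lower : ∀ {x : S.V} → Top.View x → V
    lower Top.‵fromℕ       = end
    lower (Top.‵inject₁ x) = x

    project : S.V → V
    project x = lower (Top.view x)

    project-inject₁ : ∀ x → project (inject₁ x) ≡ x
    project-inject₁ x = cong lower (Top.view-inject₁ x)

    project-fromℕ : project (fromℕ #V) ≡ end
    project-fromℕ = cong lower (Top.view-fromℕ #V)

    to : ∀ {x y} → S.Adjacent (b ∷ A) x y → Connected B (project x) (project y)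
    to (zero , here , refl) = subst₂ (Connected B) (sym project-fromℕ) (sym (project-inject₁ v)) end~v
      where
      end~v : Connected B end v
      end~v with lookup A e | lookup∘updateAt e {const (lookup A e)} A
      ... | true  | eq = fwd (e , lookup⇒[]= e _ eq , refl) ◅ ε
      ... | false | _  = ε
    to (suc i , there i∈ , eq) with i ≟ e
    to (suc i , there i∈ , refl) | yes refl =
      subst₂ (Connected B) (sym (project-inject₁ u)) (sym (trans project-fromℕ end≡u)) ε
      where
      end≡u : end ≡ u
      end≡u = cong (if_then u else v) ([]=⇒lookup i∈)
    to (suc i , there i∈ , refl) | no i≢e =
      subst₂ (Connected B) (sym (project-inject₁ _)) (sym (project-inject₁ _))
        (fwd (i , update-∈ A e i∈ (⊥-elim ∘ i≢e) , refl) ◅ ε)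

    ∧-true : ∀ {a c} → a ∧ c ≡ true → a ≡ true × c ≡ true
    ∧-true {true} eq = refl , eq

    from : ∀ {x y} → Adjacent B x y → S.Connected (b ∷ A) (inject₁ x) (inject₁ y)
    from (i , i∈ , refl) with ∈-update A e i∈
    ... | inj₂ (i≢e , i∈A) = fwd (suc i , there i∈A , subdivide-ends i≢e) ◅ ε
    ... | inj₁ (refl , eq) with refl , e∈A ← ∧-true {b} eq =
      fwd (suc e , there (lookup⇒[]= e A e∈A) , subdivide-ends-e) ◅ fwd (zero , here , refl) ◅ ε

  double-κ : ∀ b A → D.κ (b ∷ A) ≡ κ (A [ e ]≔ (b ∨ lookup A e))
  double-κ b A = count-cong (D.leastInComponent? (b ∷ A)) (leastInComponent? (A [ e ]≔ (b ∨ lookup A e))) id id λ x → mk⇔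
    (λ least y → least y ∘ Equivalence.from (double-connected b A))
    (λ least y → least y ∘ Equivalence.to (double-connected b A))

  subdivide-κ : ∀ b A → S.κ (b ∷ A) ≡
    (if b ∨ lookup A e then 0 else 1) ℕ.+ κ (A [ e ]≔ (b ∧ lookup A e))
  subdivide-κ b A = trans (count-last (S.leastInComponent? (b ∷ A)) id) (cong₂ ℕ._+_
    (new (S.leastInComponent? (b ∷ A) (fromℕ #V)))
    (count-cong (S.leastInComponent? (b ∷ A)) (leastInComponent? (A [ e ]≔ (b ∧ lookup A e))) inject₁ id λ x → mk⇔
      (λ least y c → subst₂ ℕ._≤_ (Fin.toℕ-inject₁ x) (Fin.toℕ-inject₁ y)
        (least (inject₁ y) (Equivalence.from (subdivide-connected b A) c)))
      (λ least y → old least (Top.view y))))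
    where
    old : ∀ {x y} → LeastInComponent (A [ e ]≔ (b ∧ lookup A e)) x → Top.View y →
          S.Connected (b ∷ A) y (inject₁ x) → toℕ (inject₁ x) ℕ.≤ toℕ y
    old {x} _ Top.‵fromℕ _ = subst (toℕ (inject₁ x) ℕ.≤_) (sym (Fin.toℕ-fromℕ #V)) (Fin.inject₁ℕ≤ x)
    old least (Top.‵inject₁ y) c = subst₂ ℕ._≤_ (sym (Fin.toℕ-inject₁ _)) (sym (Fin.toℕ-inject₁ y))
      (least y (Equivalence.to (subdivide-connected b A) c))

    notLeast : ∀ {x} → S.Connected (b ∷ A) (inject₁ x) (fromℕ #V) → ¬ S.LeastInComponent (b ∷ A) (fromℕ #V)
    notLeast {x} c least = ℕ.<⇒≱ (Fin.inject₁ℕ< x)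
      (subst (ℕ._≤ toℕ (inject₁ x)) (Fin.toℕ-fromℕ #V) (least (inject₁ x) c))

    isolated : b ∨ lookup A e ≡ false → ∀ {x} → S.Connected (b ∷ A) x (fromℕ #V) → x ≡ fromℕ #V
    isolated ∨-false {x} c with x ≟ fromℕ #V | EqC.gfold isEquivalence (λ y → does (y ≟ fromℕ #V)) invariant c
      where
      unequal : ∀ y → does (inject₁ y ≟ fromℕ #V) ≡ false
      unequal y = dec-false (inject₁ y ≟ fromℕ #V) (fromℕ≢inject₁ ∘ sym)

      invariant : ∀ {y z} → S.Adjacent (b ∷ A) y z → does (y ≟ fromℕ #V) ≡ does (z ≟ fromℕ #V)
      invariant (zero , here , _) = case ∨-false of λ ()
      invariant (suc i , there i∈ , refl) with i ≟ e
      ... | no _ = trans (unequal (proj₁ (ends i))) (sym (unequal (proj₂ (ends i))))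
      ... | yes refl = case trans (sym (trans (cong (b ∨_) ([]=⇒lookup i∈)) (∨-zeroʳ b))) ∨-false of λ ()
    ... | yes eq | _ = eq
    ... | no _   | eq with () ← trans eq (dec-true (fromℕ #V ≟ fromℕ #V) refl)

    joined : b ∨ lookup A e ≡ true → ∃[ x ] S.Connected (b ∷ A) (inject₁ x) (fromℕ #V)
    joined eq with ∨-case b A e eq
    ... | inj₁ refl = v , bwd (zero , here , refl) ◅ ε
    ... | inj₂ e∈A  = u , fwd (suc e , there e∈A , subdivide-ends-e) ◅ ε

    new : (least? : Dec (S.LeastInComponent (b ∷ A) (fromℕ #V))) →
          (if does least? then 1 else 0) ≡ (if b ∨ lookup A e then 0 else 1)
    new least? with b ∨ lookup A e in eq
    ... | true  = cong (if_then 1 else 0) (dec-false least? (notLeast (proj₂ (joined eq))))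
    ... | false = cong (if_then 1 else 0) (dec-true least? λ x c → ℕ.≤-reflexive (cong toℕ (sym (isolated eq c))))

⊤-update : ∀ {n} (e : Fin n) → Subset.⊤ [ e ]≔ true ≡ Subset.⊤
⊤-update e = trans (cong (Subset.⊤ [ e ]≔_) (sym (lookup-replicate e true))) ([]≔-lookup Subset.⊤ e)

module _ {G : Graph} (emb : PlaneEmbedding G) (e : Graph.E G) where
  open Graph G
  open PlaneEmbedding emb
  open Splice e
  private
    module D = Graph (double G e)
    module S = Graph (subdivide G e)

    spliceLabel-surjective : ∀ {n} {ℓ : Dart → Fin n} → Surjective _≡_ _≡_ ℓ → Surjective _≡_ _≡_ (spliceLabel ℓ)
    spliceLabel-surjective {ℓ = ℓ} surj y with Top.view y
    ... | Top.‵fromℕ     = (zero , false) , λ { refl → refl }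
    ... | Top.‵inject₁ y =
      let d , eq = surj y
      in  lift d , λ { refl → trans (spliceLabel-lift ℓ d) (cong inject₁ (eq refl)) }

  double-tail : insertLabel tail ≗ D.tail
  double-tail (zero  , false) = refl
  double-tail (zero  , true)  = refl
  double-tail (suc i , false) = refl
  double-tail (suc i , true)  = refl

  subdivide-tail : spliceLabel tail ≗ S.tail
  subdivide-tail (zero  , false) = refl
  subdivide-tail (zero  , true)  = refl
  subdivide-tail (suc i , false) = refl
  subdivide-tail (suc i , true)  = refl

  double-connected-⊤ : ∀ {x y} → D.Connected Subset.⊤ x y → Connected Subset.⊤ x y
  double-connected-⊤ {x} {y} c =
    subst (λ A → Connected A x y) (⊤-update e) (Equivalence.to (double-connected G e true Subset.⊤) c)

  subdivide-connected-⊤ : ∀ {x y} → S.Connected Subset.⊤ (inject₁ x) (inject₁ y) → Connected Subset.⊤ x y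
  subdivide-connected-⊤ {x} {y} c = subst (λ A → Connected A x y)
    (trans (cong (Subset.⊤ [ e ]≔_) (lookup-replicate e true)) (⊤-update e))
    (Equivalence.to (subdivide-connected G e true Subset.⊤) c)

  double-κ-⊤ : D.κ Subset.⊤ ≡ κ Subset.⊤
  double-κ-⊤ = trans (double-κ G e true Subset.⊤) (cong κ (⊤-update e))

  subdivide-κ-⊤ : S.κ Subset.⊤ ≡ κ Subset.⊤
  subdivide-κ-⊤ = trans (subdivide-κ G e true Subset.⊤)
    (cong κ (trans (cong (Subset.⊤ [ e ]≔_) (lookup-replicate e true)) (⊤-update e)))

  double-#isolated : D.#isolated ≡ #isolated
  double-#isolated = count-cong D.isolated? isolated? id id λ x → mk⇔
    (λ iso i → iso (suc i))
    (λ { iso zero → iso e ; iso (suc i) → iso i })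

  subdivide-#isolated : S.#isolated ≡ #isolated
  subdivide-#isolated = trans (count-last S.isolated? id) (cong₂ ℕ._+_
    (cong (if_then 1 else 0) (dec-false (S.isolated? (fromℕ #V)) (λ iso → proj₁ (iso zero) refl)))
    (count-cong S.isolated? isolated? inject₁ id λ x → mk⇔ (to x) from))
    where
    to : ∀ x → S.Isolated (inject₁ x) → Isolated x
    to x iso i = proj₁ (iso (suc i)) ∘ cong inject₁ , second
      where
      second : proj₂ (ends i) ≢ x
      second with i ≟ e | proj₂ (iso (suc i))
      ... | yes refl | _   = proj₂ (iso zero) ∘ cong inject₁
      ... | no _     | ≢x  = ≢x ∘ cong inject₁

    from : ∀ {x} → Isolated x → S.Isolated (inject₁ x)
    from iso zero = fromℕ≢inject₁ , proj₂ (iso e) ∘ inject₁-injective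
    from {x} iso (suc i) = proj₁ (iso i) ∘ inject₁-injective , second
      where
      second : proj₂ (S.ends (suc i)) ≢ inject₁ x
      second with i ≟ e
      ... | yes _ = fromℕ≢inject₁
      ... | no _  = proj₂ (iso i) ∘ inject₁-injective

  private
    rev-rev : ∀ {n} (d : Fin n × Bool) → rev (rev d) ≡ d
    rev-rev (i , false) = refl
    rev-rev (i , true)  = refl

  double-embedding : PlaneEmbedding (double G e)
  double-embedding = record
    { rotate          = splice next ∘ rev
    ; rotate-cyclic   = cyclic-congʳ double-tail
        (insert-cyclic (cyclic-cong (cong rotate ∘ sym ∘ rev-rev) rotate-cyclic))
    ; #walks          = suc #walks
    ; walk            = spliceLabel walk
    ; walk-surjective = spliceLabel-surjective walk-surjective
    ; walk-boundary   = cyclic-cong (cong (splice next) ∘ sym ∘ rev-rev) (splice-cyclic walk-boundary)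
    ; euler           = trans
        (cong (λ i → #V ℕ.+ (suc #walks ℕ.+ i)) double-#isolated)
        (trans (ℕ.+-suc #V _) (cong suc (trans euler (cong (λ k → #E ℕ.+ 2 ℕ.* k) (sym double-κ-⊤)))))
    }

  subdivide-embedding : PlaneEmbedding (subdivide G e)
  subdivide-embedding = record
    { rotate          = splice rotate
    ; rotate-cyclic   = cyclic-congʳ subdivide-tail (splice-cyclic rotate-cyclic)
    ; #walks          = #walks
    ; walk            = insertLabel walk
    ; walk-surjective = λ y → let (i , b) , eq = walk-surjective y in (suc i , b) , λ { refl → eq refl }
    ; walk-boundary   = insert-cyclic walk-boundary
    ; euler           = cong suc (trans
        (cong (λ i → #V ℕ.+ (#walks ℕ.+ i)) subdivide-#isolated)
        (trans euler (cong (λ k → #E ℕ.+ 2 ℕ.* k) (sym subdivide-κ-⊤))))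
    }

module _ (Υ : TwoTerminalPlanarGraph) (e : TwoTerminalPlanarGraph.E Υ) where
  open TwoTerminalPlanarGraph Υ
  open PlaneEmbedding embedding
  open Splice e

  double₂ : TwoTerminalPlanarGraph
  double₂ = record
    { graph     = double graph e
    ; s         = s
    ; t         = t
    ; s≢t       = s≢t
    ; embedding = double-embedding embedding e
    ; outer     = λ c → let f , bs , bt = outer (double-connected-⊤ embedding e c) in inject₁ f , boundary bs , boundary bt
    }
    where
    boundary : ∀ {f x} → OnBoundary f x → PlaneEmbedding.OnBoundary (double-embedding embedding e) (inject₁ f) x
    boundary (d , refl , refl) = lift d ,
      trans (sym (double-tail embedding e (lift d))) (insertLabel-lift tail d) ,
      spliceLabel-lift walk d

  subdivide₂ : TwoTerminalPlanarGraph
  subdivide₂ = record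
    { graph     = subdivide graph e
    ; s         = inject₁ s
    ; t         = inject₁ t
    ; s≢t       = s≢t ∘ inject₁-injective
    ; embedding = subdivide-embedding embedding e
    ; outer     = λ c → let f , bs , bt = outer (subdivide-connected-⊤ embedding e c) in f , boundary bs , boundary bt
    }
    where
    boundary : ∀ {f x} → OnBoundary f x → PlaneEmbedding.OnBoundary (subdivide-embedding embedding e) f (inject₁ x)
    boundary (d , refl , refl) = lift d ,
      trans (sym (subdivide-tail embedding e (lift d))) (spliceLabel-lift tail d) ,
      insertLabel-lift walk d

singleEdge : TwoTerminalPlanarGraph
singleEdge = record
  { graph     = record { #V = 2 ; #E = 1 ; ends = λ _ → zero , suc zero }
  ; s         = zero
  ; t         = suc zero
  ; s≢t       = λ ()
  ; embedding = record
      { rotate          = id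
      ; rotate-cyclic   = rotate-cyclic
      ; #walks          = 1
      ; walk            = λ _ → zero
      ; walk-surjective = λ { zero → (zero , false) , λ _ → refl }
      ; walk-boundary   = λ d d′ → mk⇔ (λ _ → reach d d′) (λ _ → refl)
      ; euler           = refl
      }
  ; outer     = λ _ → zero , ((zero , false) , refl , refl) , ((zero , true) , refl , refl)
  }
  where
  G : Graph
  G = record { #V = 2 ; #E = 1 ; ends = λ _ → zero , suc zero }

  rotate-cyclic : Cyclic id (Graph.tail G)
  rotate-cyclic (zero , false) (zero , false) = mk⇔ (λ _ → 0 , refl) (λ _ → refl)
  rotate-cyclic (zero , true)  (zero , true)  = mk⇔ (λ _ → 0 , refl) (λ _ → refl)
  rotate-cyclic (zero , false) (zero , true)  = mk⇔ (λ ()) (λ o → case orbit-invariant {ℓ = id} (λ _ → refl) o of λ ())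
  rotate-cyclic (zero , true)  (zero , false) = mk⇔ (λ ()) (λ o → case orbit-invariant {ℓ = id} (λ _ → refl) o of λ ())

  reach : ∀ d d′ → Orbit (Graph.reverse G) d d′
  reach (zero , false) (zero , false) = 0 , refl
  reach (zero , true)  (zero , true)  = 0 , refl
  reach (zero , false) (zero , true)  = 1 , refl
  reach (zero , true)  (zero , false) = 1 , refl

-- Partition functions

sumList : List ℚ → ℚ
sumList = foldr _+_ 0ℚ

sumList-++ : ∀ xs ys → sumList (xs ++ ys) ≡ sumList xs + sumList ys
sumList-++ []       ys = sym (ℚ.+-identityˡ _)
sumList-++ (x ∷ xs) ys = trans (cong (x +_) (sumList-++ xs ys)) (sym (ℚ.+-assoc x _ _))

sumList-filter : ∀ {A : Set} {P : A → Set} (P? : Decidable P) (f : A → ℚ) xs →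
  sumList (List.map f (filter P? xs)) ≡ sumList (List.map (λ x → if does (P? x) then f x else 0ℚ) xs)
sumList-filter P? f [] = refl
sumList-filter P? f (x ∷ xs) with does (P? x)
... | true  = cong (f x +_) (sumList-filter P? f xs)
... | false = trans (sumList-filter P? f xs) (sym (ℚ.+-identityˡ _))

subsetSum : ∀ {n} → (Subset n → ℚ) → ℚ
subsetSum {zero}  F = F []
subsetSum {suc n} F = subsetSum (F ∘ (inside ∷_)) + subsetSum (F ∘ (outside ∷_))

sumList-subsets : ∀ n (F : Subset n → ℚ) → sumList (List.map F (subsets n)) ≡ subsetSum F
sumList-subsets zero    F = ℚ.+-identityʳ _
sumList-subsets (suc n) F = begin
  sumList (List.map F (List.map (inside ∷_) (subsets n) ++ List.map (outside ∷_) (subsets n)))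
    ≡⟨ cong sumList (List.map-++ F (List.map (inside ∷_) (subsets n)) _) ⟩
  sumList (List.map F (List.map (inside ∷_) (subsets n)) ++ List.map F (List.map (outside ∷_) (subsets n)))
    ≡⟨ sumList-++ (List.map F (List.map (inside ∷_) (subsets n))) _ ⟩
  sumList (List.map F (List.map (inside ∷_) (subsets n))) + sumList (List.map F (List.map (outside ∷_) (subsets n)))
    ≡⟨ cong₂ (λ xs ys → sumList xs + sumList ys) (sym (List.map-∘ (subsets n))) (sym (List.map-∘ (subsets n))) ⟩
  sumList (List.map (F ∘ (inside ∷_)) (subsets n)) + sumList (List.map (F ∘ (outside ∷_)) (subsets n))
    ≡⟨ cong₂ _+_ (sumList-subsets n _) (sumList-subsets n _) ⟩
  subsetSum F ∎
  where open ≡-Reasoning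

subsetSum-cong : ∀ {n} (F G : Subset n → ℚ) → F ≗ G → subsetSum F ≡ subsetSum G
subsetSum-cong {zero}  F G F≗G = F≗G []
subsetSum-cong {suc n} F G F≗G = cong₂ _+_
  (subsetSum-cong (F ∘ (inside ∷_)) (G ∘ (inside ∷_)) (F≗G ∘ (inside ∷_)))
  (subsetSum-cong (F ∘ (outside ∷_)) (G ∘ (outside ∷_)) (F≗G ∘ (outside ∷_)))

interchange : ∀ a b c d → (a + b) + (c + d) ≡ (a + c) + (b + d)
interchange = solve 4 (λ a b c d → (a :+ b) :+ (c :+ d) := (a :+ c) :+ (b :+ d)) refl

subsetSum-+ : ∀ {n} (F G : Subset n → ℚ) → subsetSum (λ A → F A + G A) ≡ subsetSum F + subsetSum G
subsetSum-+ {zero}  F G = refl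
subsetSum-+ {suc n} F G = trans
  (cong₂ _+_ (subsetSum-+ (F ∘ (inside ∷_)) (G ∘ (inside ∷_))) (subsetSum-+ (F ∘ (outside ∷_)) (G ∘ (outside ∷_))))
  (interchange (subsetSum (F ∘ (inside ∷_))) (subsetSum (G ∘ (inside ∷_)))
               (subsetSum (F ∘ (outside ∷_))) (subsetSum (G ∘ (outside ∷_))))

subsetSum-* : ∀ {n} c (F : Subset n → ℚ) → subsetSum (λ A → c * F A) ≡ c * subsetSum F
subsetSum-* {zero}  c F = refl
subsetSum-* {suc n} c F = trans
  (cong₂ _+_ (subsetSum-* c (F ∘ (inside ∷_))) (subsetSum-* c (F ∘ (outside ∷_))))
  (sym (ℚ.*-distribˡ-+ c (subsetSum (F ∘ (inside ∷_))) (subsetSum (F ∘ (outside ∷_)))))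

subsetSum-pair : ∀ {n} (e : Fin n) (F G : Subset n → ℚ) →
  (∀ A → F (A [ e ]≔ inside) + F (A [ e ]≔ outside) ≡ G (A [ e ]≔ inside) + G (A [ e ]≔ outside)) →
  subsetSum F ≡ subsetSum G
subsetSum-pair {suc n} zero F G eq = begin
  subsetSum (F ∘ (inside ∷_)) + subsetSum (F ∘ (outside ∷_))
    ≡⟨ subsetSum-+ (F ∘ (inside ∷_)) (F ∘ (outside ∷_)) ⟨
  subsetSum (λ A → F (inside ∷ A) + F (outside ∷ A))
    ≡⟨ subsetSum-cong (λ A → F (inside ∷ A) + F (outside ∷ A)) (λ A → G (inside ∷ A) + G (outside ∷ A)) (λ A → eq (inside ∷ A)) ⟩
  subsetSum (λ A → G (inside ∷ A) + G (outside ∷ A))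
    ≡⟨ subsetSum-+ (G ∘ (inside ∷_)) (G ∘ (outside ∷_)) ⟩
  subsetSum (G ∘ (inside ∷_)) + subsetSum (G ∘ (outside ∷_)) ∎
  where open ≡-Reasoning
subsetSum-pair (suc e) F G eq = cong₂ _+_
  (subsetSum-pair e (F ∘ (inside ∷_)) (G ∘ (inside ∷_)) (λ A → eq (inside ∷ A)))
  (subsetSum-pair e (F ∘ (outside ∷_)) (G ∘ (outside ∷_)) (λ A → eq (outside ∷ A)))

product-cong : ∀ {n} {f g : Fin n → ℚ} → f ≗ g → product +-*-rawSemiring f ≡ product ℚ.+-*-rawSemiring g
product-cong {zero}  f≗g = refl
product-cong {suc n} f≗g = cong₂ _*_ (f≗g zero) (product-cong (f≗g ∘ suc))

weight : ∀ {n} → (Fin n → ℚ) → Subset n → ℚ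
weight ŵ A = product +-*-rawSemiring (λ e → if lookup A e then ŵ e else 1ℚ)

weight-inside : ∀ {n} (ŵ : Fin n → ℚ) A e → weight ŵ (A [ e ]≔ inside) ≡ ŵ e * weight ŵ (A [ e ]≔ outside)
weight-inside ŵ (x ∷ A) zero    = cong (ŵ zero *_) (sym (ℚ.*-identityˡ _))
weight-inside ŵ (x ∷ A) (suc e) = trans (cong ((if x then ŵ zero else 1ℚ) *_) (weight-inside (ŵ ∘ suc) A e))
  (solve 3 (λ a b c → a :* (b :* c) := b :* (a :* c)) refl (if x then ŵ zero else 1ℚ) (ŵ (suc e))
    (weight (ŵ ∘ suc) (A [ e ]≔ outside)))

weight-outside : ∀ {n} {ŵ ŵ′ : Fin n → ℚ} A e → (∀ i → i ≢ e → ŵ i ≡ ŵ′ i) →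
                 weight ŵ (A [ e ]≔ outside) ≡ weight ŵ′ (A [ e ]≔ outside)
weight-outside {ŵ = ŵ} {ŵ′} A e eq = product-cong pointwise
  where
  pointwise : ∀ i → (if lookup (A [ e ]≔ outside) i then ŵ i else 1ℚ) ≡ (if lookup (A [ e ]≔ outside) i then ŵ′ i else 1ℚ)
  pointwise i with i ≟ e
  ... | yes refl rewrite lookup∘updateAt e {const outside} A = refl
  ... | no i≢e   = cong (if lookup (A [ e ]≔ outside) i then_else 1ℚ) (eq i i≢e)

subsetSum-merge : ∀ {n} (e : Fin n) (ŵ : Fin n → ℚ) (ŵ′ : Fin (suc n) → ℚ) (C : Subset n → ℚ) (C′ : Subset (suc n) → ℚ) c →
  (∀ i → i ≢ e → ŵ′ (suc i) ≡ ŵ i) →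
  (∀ A → let u = ŵ′ (suc e) ; v = ŵ′ zero ; A₁ = A [ e ]≔ inside ; A₀ = A [ e ]≔ outside in
    (v * u * C′ (inside ∷ A₁) + u * C′ (outside ∷ A₁)) + (v * C′ (inside ∷ A₀) + C′ (outside ∷ A₀)) ≡
    c * (ŵ e * C A₁ + C A₀)) →
  subsetSum (λ A → weight ŵ′ A * C′ A) ≡ c * subsetSum (λ A → weight ŵ A * C A)
subsetSum-merge e ŵ ŵ′ C C′ c agree local = begin
  subsetSum (λ A → weight ŵ′ A * C′ A)
    ≡⟨ subsetSum-+ (λ A → weight ŵ′ (inside ∷ A) * C′ (inside ∷ A)) (λ A → weight ŵ′ (outside ∷ A) * C′ (outside ∷ A)) ⟨
  subsetSum (λ A → weight ŵ′ (inside ∷ A) * C′ (inside ∷ A) + weight ŵ′ (outside ∷ A) * C′ (outside ∷ A))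
    ≡⟨ subsetSum-pair e _ (λ A → c * (weight ŵ A * C A)) pair ⟩
  subsetSum (λ A → c * (weight ŵ A * C A))
    ≡⟨ subsetSum-* c (λ A → weight ŵ A * C A) ⟩
  c * subsetSum (λ A → weight ŵ A * C A) ∎
  where
  open ≡-Reasoning
  u v w : ℚ
  u = ŵ′ (suc e)
  v = ŵ′ zero
  w = ŵ e
  pair : ∀ A → let A₁ = A [ e ]≔ inside ; A₀ = A [ e ]≔ outside in
    (weight ŵ′ (inside ∷ A₁) * C′ (inside ∷ A₁) + weight ŵ′ (outside ∷ A₁) * C′ (outside ∷ A₁)) +
    (weight ŵ′ (inside ∷ A₀) * C′ (inside ∷ A₀) + weight ŵ′ (outside ∷ A₀) * C′ (outside ∷ A₀)) ≡
    c * (weight ŵ A₁ * C A₁) + c * (weight ŵ A₀ * C A₀)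
  pair A = begin
    (v * weight (ŵ′ ∘ suc) A₁ * C₁₁ + 1ℚ * weight (ŵ′ ∘ suc) A₁ * C₀₁) +
    (v * W′ * C₁₀ + 1ℚ * W′ * C₀₀)
      ≡⟨ cong₂ (λ x y → (v * x * C₁₁ + 1ℚ * x * C₀₁) + (v * y * C₁₀ + 1ℚ * y * C₀₀))
           (trans (weight-inside (ŵ′ ∘ suc) A e) (cong (u *_) W′≡W)) W′≡W ⟩
    (v * (u * W) * C₁₁ + 1ℚ * (u * W) * C₀₁) + (v * W * C₁₀ + 1ℚ * W * C₀₀)
      ≡⟨ solve 7 (λ u v W a b c d →
           (v :* (u :* W) :* a :+ con 1ℚ :* (u :* W) :* b) :+ (v :* W :* c :+ con 1ℚ :* W :* d) :=
           W :* ((v :* u :* a :+ u :* b) :+ (v :* c :+ d))) refl u v W C₁₁ C₀₁ C₁₀ C₀₀ ⟩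
    W * ((v * u * C₁₁ + u * C₀₁) + (v * C₁₀ + C₀₀))
      ≡⟨ cong (W *_) (local A) ⟩
    W * (c * (w * C A₁ + C A₀))
      ≡⟨ solve 5 (λ W c w a b → W :* (c :* (w :* a :+ b)) := c :* (w :* W :* a) :+ c :* (W :* b)) refl W c w (C A₁) (C A₀) ⟩
    c * (w * W * C A₁) + c * (W * C A₀)
      ≡⟨ cong (λ x → c * (x * C A₁) + c * (W * C A₀)) (weight-inside ŵ A e) ⟨
    c * (weight ŵ A₁ * C A₁) + c * (W * C A₀) ∎
    where
    A₁ = A [ e ]≔ inside
    A₀ = A [ e ]≔ outside
    C₁₁ = C′ (inside ∷ A₁)
    C₀₁ = C′ (outside ∷ A₁)
    C₁₀ = C′ (inside ∷ A₀)
    C₀₀ = C′ (outside ∷ A₀)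
    W  = weight ŵ A₀
    W′ = weight (ŵ′ ∘ suc) A₀
    W′≡W : W′ ≡ W
    W′≡W = weight-outside A e agree

module _ (q : ℚ) where

  module _ (Υ : TwoTerminalPlanarGraph) where
    open TwoTerminalPlanarGraph Υ

    -- With X = id the subsets connecting s and t are kept, with X = not those
    -- separating them.
    core : (Bool → Bool) → Subset #E → ℚ
    core X A = if X (does (connected? A s t)) then q ^ℚ κ A else 0ℚ

    Z : (Bool → Bool) → (E → ℚ) → ℚ
    Z X ŵ = subsetSum (λ A → weight ŵ A * core X A)

    private
      weighted : ∀ b x y → (if b then x * y else 0ℚ) ≡ x * (if b then y else 0ℚ)
      weighted true  x y = refl
      weighted false x y = sym (ℚ.*-zeroʳ x)

    Z-st≡Z : ∀ ŵ → Z-st q Υ ŵ ≡ Z id ŵ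
    Z-st≡Z ŵ = trans (sumList-filter (λ A → connected? A s t) (term q Υ ŵ) (subsets #E))
      (trans (sumList-subsets #E _) (subsetSum-cong _ _ (λ A → weighted (does (connected? A s t)) (weight ŵ A) _)))

    Z-s∣t≡Z : ∀ ŵ → Z-s∣t q Υ ŵ ≡ Z not ŵ
    Z-s∣t≡Z ŵ = trans (sumList-filter (λ A → ¬? (connected? A s t)) (term q Υ ŵ) (subsets #E))
      (trans (sumList-subsets #E _) (subsetSum-cong _ _ (λ A → weighted (not (does (connected? A s t))) (weight ŵ A) _)))

  module _ (Υ : TwoTerminalPlanarGraph) (e : TwoTerminalPlanarGraph.E Υ) where
    open TwoTerminalPlanarGraph Υ

    double-core : ∀ X b A → core (double₂ Υ e) X (b ∷ A) ≡ core Υ X (A [ e ]≔ (b ∨ lookup A e))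
    double-core X b A = cong₂ (λ c k → if X c then q ^ℚ k else 0ℚ)
      (does-⇔ (double-connected graph e b A) (Graph.connected? (double graph e) (b ∷ A) s t) (connected? _ s t))
      (double-κ graph e b A)

    subdivide-core : ∀ X b A → core (subdivide₂ Υ e) X (b ∷ A) ≡
      (if b ∨ lookup A e then 1ℚ else q) * core Υ X (A [ e ]≔ (b ∧ lookup A e))
    subdivide-core X b A = trans
      (cong₂ (λ c k → if X c then q ^ℚ k else 0ℚ)
        (does-⇔ (subdivide-connected graph e b A)
          (Graph.connected? (subdivide graph e) (b ∷ A) (inject₁ s) (inject₁ t)) (connected? B s t))
        (subdivide-κ graph e b A))
      (factor (X (does (connected? B s t))) (b ∨ lookup A e))
      where
      B = A [ e ]≔ (b ∧ lookup A e)
      factor : ∀ x y → (if x then q ^ℚ ((if y then 0 else 1) ℕ.+ κ B) else 0ℚ) ≡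
                       (if y then 1ℚ else q) * (if x then q ^ℚ κ B else 0ℚ)
      factor true  true  = sym (ℚ.*-identityˡ _)
      factor true  false = refl
      factor false y     = sym (ℚ.*-zeroʳ (if y then 1ℚ else q))

    module _ {ŵ : E → ℚ} {ŵ′ : Fin (suc #E) → ℚ} (agree : ∀ i → i ≢ e → ŵ′ (suc i) ≡ ŵ i) where

      private
        u v w : ℚ
        u = ŵ′ (suc e)
        v = ŵ′ zero
        w = ŵ e

      double-Z : 1ℚ + w ≡ (1ℚ + u) * (1ℚ + v) → ∀ X → Z (double₂ Υ e) X ŵ′ ≡ 1ℚ * Z Υ X ŵ
      double-Z eq X = subsetSum-merge e ŵ ŵ′ (core Υ X) (core (double₂ Υ e) X) 1ℚ agree local
        where
        open ≡-Reasoning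
        C′ = core (double₂ Υ e) X
        local : ∀ A → let A₁ = A [ e ]≔ inside ; A₀ = A [ e ]≔ outside in
          (v * u * C′ (inside ∷ A₁) + u * C′ (outside ∷ A₁)) + (v * C′ (inside ∷ A₀) + C′ (outside ∷ A₀)) ≡
          1ℚ * (w * core Υ X A₁ + core Υ X A₀)
        local A = begin
            (v * u * C′ (inside ∷ A₁) + u * C′ (outside ∷ A₁)) + (v * C′ (inside ∷ A₀) + C′ (outside ∷ A₀))
              ≡⟨ cong₂ _+_ (cong₂ (λ x y → v * u * x + u * y) (add A₁ ([]≔-idempotent A e)) (keep A₁))
                           (cong₂ (λ x y → v * x + y) (add A₀ ([]≔-idempotent A e)) (keep A₀)) ⟩
            (v * u * C₁ + u * C₁) + (v * C₁ + C₀)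
              ≡⟨ solve 4 (λ u v C₁ C₀ → (v :* u :* C₁ :+ u :* C₁) :+ (v :* C₁ :+ C₀) :=
                   ((con 1ℚ :+ u) :* (con 1ℚ :+ v) :- con 1ℚ) :* C₁ :+ C₀) refl u v C₁ C₀ ⟩
            ((1ℚ + u) * (1ℚ + v) - 1ℚ) * C₁ + C₀
              ≡⟨ cong (λ x → (x - 1ℚ) * C₁ + C₀) eq ⟨
            ((1ℚ + w) - 1ℚ) * C₁ + C₀
              ≡⟨ solve 3 (λ w C₁ C₀ → ((con 1ℚ :+ w) :- con 1ℚ) :* C₁ :+ C₀ := con 1ℚ :* (w :* C₁ :+ C₀)) refl w C₁ C₀ ⟩
            1ℚ * (w * C₁ + C₀) ∎
          where
          A₁ = A [ e ]≔ inside
          A₀ = A [ e ]≔ outside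
          C₁ = core Υ X A₁
          C₀ = core Υ X A₀
          add : ∀ B → B [ e ]≔ inside ≡ A₁ → C′ (inside ∷ B) ≡ C₁
          add B eq = trans (double-core X inside B) (cong (core Υ X) eq)
          keep : ∀ B → C′ (outside ∷ B) ≡ core Υ X B
          keep B = trans (double-core X outside B) (cong (core Υ X) ([]≔-lookup B e))

      subdivide-Z : w * (q + u + v) ≡ u * v → ∀ X → Z (subdivide₂ Υ e) X ŵ′ ≡ (q + u + v) * Z Υ X ŵ
      subdivide-Z eq X = subsetSum-merge e ŵ ŵ′ (core Υ X) (core (subdivide₂ Υ e) X) (q + u + v) agree local
        where
        open ≡-Reasoning
        C′ = core (subdivide₂ Υ e) X
        local : ∀ A → let A₁ = A [ e ]≔ inside ; A₀ = A [ e ]≔ outside in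
          (v * u * C′ (inside ∷ A₁) + u * C′ (outside ∷ A₁)) + (v * C′ (inside ∷ A₀) + C′ (outside ∷ A₀)) ≡
          (q + u + v) * (w * core Υ X A₁ + core Υ X A₀)
        local A = begin
            (v * u * C′ (inside ∷ A₁) + u * C′ (outside ∷ A₁)) + (v * C′ (inside ∷ A₀) + C′ (outside ∷ A₀))
              ≡⟨ cong₂ _+_ (cong₂ (λ x y → v * u * x + u * y) (keep A₁) (remove A₁ (lookup∘updateAt e A) ([]≔-idempotent A e)))
                           (cong₂ (λ x y → v * x + y) (keep A₀) (remove A₀ (lookup∘updateAt e A) ([]≔-idempotent A e))) ⟩
            (v * u * (1ℚ * C₁) + u * (1ℚ * C₀)) + (v * (1ℚ * C₀) + q * C₀)
              ≡⟨ solve 5 (λ q u v C₁ C₀ →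
                   (v :* u :* (con 1ℚ :* C₁) :+ u :* (con 1ℚ :* C₀)) :+ (v :* (con 1ℚ :* C₀) :+ q :* C₀) :=
                   (u :* v) :* C₁ :+ (q :+ u :+ v) :* C₀) refl q u v C₁ C₀ ⟩
            (u * v) * C₁ + (q + u + v) * C₀
              ≡⟨ cong (λ x → x * C₁ + (q + u + v) * C₀) eq ⟨
            (w * (q + u + v)) * C₁ + (q + u + v) * C₀
              ≡⟨ solve 4 (λ w s C₁ C₀ → (w :* s) :* C₁ :+ s :* C₀ := s :* (w :* C₁ :+ C₀)) refl w (q + u + v) C₁ C₀ ⟩
            (q + u + v) * (w * C₁ + C₀) ∎
          where
          A₁ = A [ e ]≔ inside
          A₀ = A [ e ]≔ outside
          C₁ = core Υ X A₁
          C₀ = core Υ X A₀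
          keep : ∀ B → C′ (inside ∷ B) ≡ 1ℚ * core Υ X B
          keep B = trans (subdivide-core X inside B) (cong (λ B → 1ℚ * core Υ X B) ([]≔-lookup B e))
          remove : ∀ B {b} → lookup B e ≡ b → B [ e ]≔ outside ≡ A₀ → C′ (outside ∷ B) ≡ (if b then 1ℚ else q) * C₀
          remove B e∈ eq = trans (subdivide-core X outside B)
            (cong₂ (λ b B → (if b then 1ℚ else q) * core Υ X B) e∈ eq)

-- Series-parallel networks

open TwoTerminalPlanarGraph using (E; #V; #E; size)

module _ {d : ℚ} (d≢0 : d ≢ 0ℚ) where

  private instance
    d-nonZero : NonZero d
    d-nonZero = ≢-nonZero d≢0

  *⇒÷ : ∀ {x n} → x * d ≡ n → x ≡ n ÷ d
  *⇒÷ {x} refl = begin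
    x              ≡⟨ ℚ.*-identityʳ x ⟨
    x * 1ℚ         ≡⟨ cong (x *_) (ℚ.*-inverseʳ d) ⟨
    x * (d * 1/ d) ≡⟨ ℚ.*-assoc x d (1/ d) ⟨
    x * d * 1/ d   ∎
    where open ≡-Reasoning

  ÷⇒* : ∀ {x n} → x ≡ n ÷ d → x * d ≡ n
  ÷⇒* {n = n} refl = begin
    n * 1/ d * d   ≡⟨ ℚ.*-assoc n (1/ d) d ⟩
    n * (1/ d * d) ≡⟨ cong (n *_) (ℚ.*-inverseˡ d) ⟩
    n * 1ℚ         ≡⟨ ℚ.*-identityʳ n ⟩
    n              ∎
    where open ≡-Reasoning

  *-≢0 : ∀ {x} → x ≢ 0ℚ → x * d ≢ 0ℚ
  *-≢0 x≢0 xd≡0 = x≢0 (trans (*⇒÷ xd≡0) (ℚ.*-zeroˡ (1/ d)))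

module _ {n : ℕ} (e : Fin n) (u v : ℚ) (ŵ : Fin n → ℚ) where

  split : Fin (suc n) → ℚ
  split zero    = v
  split (suc i) = if does (i ≟ e) then u else ŵ i

  split-e : split (suc e) ≡ u
  split-e with e ≟ e
  ... | yes _  = refl
  ... | no e≢e = ⊥-elim (e≢e refl)

  split-agree : ∀ i → i ≢ e → split (suc i) ≡ ŵ i
  split-agree i i≢e with i ≟ e
  ... | yes i≡e = ⊥-elim (i≢e i≡e)
  ... | no _    = refl

module _ (q : ℚ) where

  implements⁺ : ∀ {Υ ŵ w} → Z q Υ not ŵ ≢ 0ℚ → w * Z q Υ not ŵ ≡ q * Z q Υ id ŵ → Implements q Υ ŵ w
  implements⁺ {Υ} {ŵ} {w} Z≢0 eq = Z-s∣t≢0 , *⇒÷ Z-s∣t≢0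
    (trans (cong (w *_) (Z-s∣t≡Z q Υ ŵ)) (trans eq (cong (q *_) (sym (Z-st≡Z q Υ ŵ)))))
    where
    Z-s∣t≢0 : Z-s∣t q Υ ŵ ≢ 0ℚ
    Z-s∣t≢0 = Z≢0 ∘ trans (sym (Z-s∣t≡Z q Υ ŵ))

  implements-scale : ∀ {Υ Υ′ ŵ ŵ′ w c} → c ≢ 0ℚ → (∀ X → Z q Υ′ X ŵ′ ≡ c * Z q Υ X ŵ) →
                     Implements q Υ ŵ w → Implements q Υ′ ŵ′ w
  implements-scale {Υ} {Υ′} {ŵ} {ŵ′} {w} {c} c≢0 scale (Z-s∣t≢0 , w≡) =
    implements⁺ {Υ′} {ŵ′} (*-≢0 Z≢0 c≢0 ∘ trans (sym (scale not))) (begin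
      w * Z q Υ′ not ŵ′      ≡⟨ cong (w *_) (scale not) ⟩
      w * (c * Z q Υ not ŵ)  ≡⟨ solve 3 (λ w c z → w :* (c :* z) := c :* (w :* z)) refl w c (Z q Υ not ŵ) ⟩
      c * (w * Z q Υ not ŵ)  ≡⟨ cong (c *_) eq ⟩
      c * (q * Z q Υ id ŵ)   ≡⟨ solve 3 (λ q c z → c :* (q :* z) := q :* (c :* z)) refl q c (Z q Υ id ŵ) ⟩
      q * (c * Z q Υ id ŵ)   ≡⟨ cong (q *_) (scale id) ⟨
      q * Z q Υ′ id ŵ′       ∎)
    where
    open ≡-Reasoning
    Z≢0 : Z q Υ not ŵ ≢ 0ℚ
    Z≢0 = Z-s∣t≢0 ∘ trans (Z-s∣t≡Z q Υ ŵ)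
    eq : w * Z q Υ not ŵ ≡ q * Z q Υ id ŵ
    eq = trans (cong (w *_) (sym (Z-s∣t≡Z q Υ ŵ))) (trans (÷⇒* Z-s∣t≢0 w≡) (cong (q *_) (Z-st≡Z q Υ ŵ)))

  singleEdge-implements : q ≢ 0ℚ → ∀ w → Implements q singleEdge (const w) w
  singleEdge-implements q≢0 w = implements⁺ {singleEdge} {const w}
    (*-≢0 q≢0 q≢0 ∘ trans (sym separated))
    (trans (cong (w *_) separated) (trans (solve 2 (λ w q → w :* (q :* q) := q :* (w :* q)) refl w q) (cong (q *_) (sym connected))))
    where
    separated : Z q singleEdge not (const w) ≡ q * q
    separated = solve 2 (λ w q → (w :* con 1ℚ) :* con 0ℚ :+ (con 1ℚ :* con 1ℚ) :* (q :* (q :* con 1ℚ)) := q :* q) refl w q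
    connected : Z q singleEdge id (const w) ≡ w * q
    connected = solve 2 (λ w q → (w :* con 1ℚ) :* (q :* con 1ℚ) :+ (con 1ℚ :* con 1ℚ) :* con 0ℚ := w :* q) refl w q

  module _ (α : ℚ) where

    -- The effective weights of series-parallel networks with n edges of weight α.
    data Realisable : ℕ → ℚ → Set where
      edge     : Realisable 1 α
      parallel : ∀ {m n u v w} → Realisable m u → Realisable n v →
                 1ℚ + w ≡ (1ℚ + u) * (1ℚ + v) → Realisable (m ℕ.+ n) w
      series   : ∀ {m n u v w} → Realisable m u → Realisable n v →
                 q + u + v ≢ 0ℚ → w * (q + u + v) ≡ u * v → Realisable (m ℕ.+ n) w

    -- The outcome of replacing e by a network with n edges of weight α; the other
    -- edges i of Υ survive as embed i.
    record Expansion (Υ : TwoTerminalPlanarGraph) (ŵ : E Υ → ℚ) (e : E Υ) (w : ℚ) (n : ℕ) : Set where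
      field
        Υ′         : TwoTerminalPlanarGraph
        ŵ′         : E Υ′ → ℚ
        implements : Implements q Υ′ ŵ′ w
        embed      : E Υ → E Υ′
        injective  : ∀ {i j} → embed i ≡ embed j → i ≡ j
        agree      : ∀ {i} → i ≢ e → ŵ′ (embed i) ≡ ŵ i
        cover      : ∀ j → ŵ′ j ≡ α ⊎ ∃[ i ] i ≢ e × j ≡ embed i
        size≤      : 2 ℕ.+ size Υ′ ℕ.≤ size Υ ℕ.+ 2 ℕ.* n

    expand : ∀ {n v} → Realisable n v → ∀ Υ ŵ e {w} → ŵ e ≡ v → Implements q Υ ŵ w → Expansion Υ ŵ e w n

    expand-both : ∀ {m n u v} → Realisable m u → Realisable n v →
      ∀ {Υ ŵ e w} Υ₁ ŵ₁ (new : E Υ₁) (old : E Υ → E Υ₁) →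
      (∀ {i j} → old i ≡ old j → i ≡ j) → (∀ {i} → new ≢ old i) → (∀ j → j ≡ new ⊎ ∃[ i ] j ≡ old i) →
      size Υ₁ ℕ.≤ 2 ℕ.+ size Υ →
      ŵ₁ (old e) ≡ u → ŵ₁ new ≡ v → (∀ i → i ≢ e → ŵ₁ (old i) ≡ ŵ i) →
      Implements q Υ₁ ŵ₁ w → Expansion Υ ŵ e w (m ℕ.+ n)
    expand-both {m} {n} ru rv {Υ} {ŵ} {e} Υ₁ ŵ₁ new old old-injective new≢old classify size₁≤ ŵ₁e ŵ₁new ŵ₁-agree impl = record
      { Υ′         = X₂.Υ′
      ; ŵ′         = X₂.ŵ′
      ; implements = X₂.implements
      ; embed      = X₂.embed ∘ X₁.embed ∘ old
      ; injective  = old-injective ∘ X₁.injective ∘ X₂.injective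
      ; agree      = λ {i} i≢e → trans (X₂.agree (λ eq → new≢old (sym (X₁.injective eq))))
                       (trans (X₁.agree (i≢e ∘ old-injective)) (ŵ₁-agree i i≢e))
      ; cover      = cover
      ; size≤      = ℕ.+-cancelˡ-≤ 2 _ _ (begin
          2 ℕ.+ (2 ℕ.+ size X₂.Υ′)                    ≤⟨ ℕ.+-monoʳ-≤ 2 X₂.size≤ ⟩
          2 ℕ.+ size X₁.Υ′ ℕ.+ 2 ℕ.* n                ≤⟨ ℕ.+-monoˡ-≤ (2 ℕ.* n) X₁.size≤ ⟩
          size Υ₁ ℕ.+ 2 ℕ.* m ℕ.+ 2 ℕ.* n             ≤⟨ ℕ.+-monoˡ-≤ (2 ℕ.* n) (ℕ.+-monoˡ-≤ (2 ℕ.* m) size₁≤) ⟩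
          2 ℕ.+ size Υ ℕ.+ 2 ℕ.* m ℕ.+ 2 ℕ.* n        ≡⟨ ℕ-solve 3 (λ s m n → ℕ-con 2 ⊕ s ⊕ ℕ-con 2 ⊗ m ⊕ ℕ-con 2 ⊗ n ⊜
                                                            ℕ-con 2 ⊕ (s ⊕ ℕ-con 2 ⊗ (m ⊕ n))) refl (size Υ) m n ⟩
          2 ℕ.+ (size Υ ℕ.+ 2 ℕ.* (m ℕ.+ n))          ∎)
      }
      where
      open ℕ.≤-Reasoning
      module X₁ = Expansion (expand ru Υ₁ ŵ₁ (old e) ŵ₁e impl)
      module X₂ = Expansion (expand rv X₁.Υ′ X₁.ŵ′ (X₁.embed new) (trans (X₁.agree new≢old) ŵ₁new) X₁.implements)

      cover : ∀ j → X₂.ŵ′ j ≡ α ⊎ ∃[ i ] i ≢ e × j ≡ X₂.embed (X₁.embed (old i))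
      cover j = outer (X₂.cover j)
        where
        inner : ∀ {j₁} → j₁ ≢ X₁.embed new → X₁.ŵ′ j₁ ≡ α ⊎ ∃[ j₀ ] j₀ ≢ old e × j₁ ≡ X₁.embed j₀ →
                X₂.ŵ′ (X₂.embed j₁) ≡ α ⊎ ∃[ i ] i ≢ e × X₂.embed j₁ ≡ X₂.embed (X₁.embed (old i))
        inner j₁≢ (inj₁ eq) = inj₁ (trans (X₂.agree j₁≢) eq)
        inner j₁≢ (inj₂ (j₀ , j₀≢ , refl)) = inj₂ (settle (classify j₀))
          where
          settle : j₀ ≡ new ⊎ ∃[ i ] j₀ ≡ old i → ∃[ i ] i ≢ e × X₂.embed (X₁.embed j₀) ≡ X₂.embed (X₁.embed (old i))
          settle (inj₁ refl)       = ⊥-elim (j₁≢ refl)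
          settle (inj₂ (i , refl)) = i , j₀≢ ∘ cong old , refl

        outer : ∀ {j} → X₂.ŵ′ j ≡ α ⊎ ∃[ j₁ ] j₁ ≢ X₁.embed new × j ≡ X₂.embed j₁ →
                X₂.ŵ′ j ≡ α ⊎ ∃[ i ] i ≢ e × j ≡ X₂.embed (X₁.embed (old i))
        outer (inj₁ eq)               = inj₁ eq
        outer (inj₂ (j₁ , j₁≢ , refl)) = inner j₁≢ (X₁.cover j₁)

    size-double : ∀ Υ → #V Υ ℕ.+ suc (#E Υ) ℕ.≤ 2 ℕ.+ size Υ
    size-double Υ = ℕ.≤-trans (ℕ.≤-reflexive (ℕ.+-suc (#V Υ) (#E Υ))) (ℕ.n≤1+n _)

    size-subdivide : ∀ Υ → suc (#V Υ) ℕ.+ suc (#E Υ) ℕ.≤ 2 ℕ.+ size Υ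
    size-subdivide Υ = ℕ.≤-reflexive (cong suc (ℕ.+-suc (#V Υ) (#E Υ)))

    expand edge Υ ŵ e ŵe impl = record
      { Υ′         = Υ
      ; ŵ′         = ŵ
      ; implements = impl
      ; embed      = id
      ; injective  = id
      ; agree      = λ _ → refl
      ; cover      = cover
      ; size≤      = ℕ.≤-reflexive (ℕ.+-comm 2 (size Υ))
      }
      where
      cover : ∀ j → ŵ j ≡ α ⊎ ∃[ i ] i ≢ e × j ≡ i
      cover j with j ≟ e
      ... | yes refl = inj₁ ŵe
      ... | no j≢e   = inj₂ (j , j≢e , refl)
    expand (parallel {u = u} {v} ru rv eq) Υ ŵ e refl impl =
      expand-both ru rv (double₂ Υ e) (split e u v ŵ) zero suc Fin.suc-injective (λ ())
        (λ { zero → inj₁ refl ; (suc i) → inj₂ (i , refl) })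
        (size-double Υ)
        (split-e e u v ŵ) refl (split-agree e u v ŵ)
        (implements-scale {Υ} {double₂ Υ e} {ŵ} {split e u v ŵ} {c = 1ℚ} ℚ.1≢0
          (double-Z q Υ e {ŵ} {split e u v ŵ} (split-agree e u v ŵ)
            (subst (λ x → 1ℚ + ŵ e ≡ (1ℚ + x) * (1ℚ + v)) (sym (split-e e u v ŵ)) eq)) impl)
    expand (series {u = u} {v} ru rv sum≢0 eq) Υ ŵ e refl impl =
      expand-both ru rv (subdivide₂ Υ e) (split e u v ŵ) zero suc Fin.suc-injective (λ ())
        (λ { zero → inj₁ refl ; (suc i) → inj₂ (i , refl) })
        (size-subdivide Υ)
        (split-e e u v ŵ) refl (split-agree e u v ŵ)
        (implements-scale {Υ} {subdivide₂ Υ e} {ŵ} {split e u v ŵ} {c = q + split e u v ŵ (suc e) + v}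
          (subst (λ x → q + x + v ≢ 0ℚ) (sym (split-e e u v ŵ)) sum≢0)
          (subdivide-Z q Υ e {ŵ} {split e u v ŵ} (split-agree e u v ŵ)
            (subst (λ x → ŵ e * (q + x + v) ≡ x * v) (sym (split-e e u v ŵ)) eq)) impl)

    expand-only : ∀ {n w} → Realisable n w → ∀ Υ ŵ e → (∀ i → i ≡ e) → ŵ e ≡ w → Implements q Υ ŵ w →
      Σ[ Υ′ ∈ TwoTerminalPlanarGraph ] Σ[ ŵ′ ∈ (E Υ′ → ℚ) ]
        (∀ e → ŵ′ e ≡ α) × Implements q Υ′ ŵ′ w × 2 ℕ.+ size Υ′ ℕ.≤ size Υ ℕ.+ 2 ℕ.* n
    expand-only r Υ ŵ e only ŵe impl = Υ′ , ŵ′ , all-α , implements , size≤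
      where
      open Expansion (expand r Υ ŵ e ŵe impl)
      all-α : ∀ e → ŵ′ e ≡ α
      all-α e with cover e
      ... | inj₁ eq             = eq
      ... | inj₂ (i , i≢e , _) = ⊥-elim (i≢e (only i))

    realise : q ≢ 0ℚ → ∀ {n w} → Realisable n w →
      Σ[ Υ ∈ TwoTerminalPlanarGraph ] Σ[ ŵ ∈ (E Υ → ℚ) ]
        (∀ e → ŵ e ≡ α) × Implements q Υ ŵ w × 2 ℕ.+ size Υ ℕ.≤ 3 ℕ.+ 2 ℕ.* n
    realise q≢0 {n} {w} r =
      expand-only r singleEdge (const w) zero (λ { zero → refl }) refl (singleEdge-implements q≢0 w)

-- Rational arithmetic

*-0≤ : ∀ {x y} → 0ℚ ≤ x → 0ℚ ≤ y → 0ℚ ≤ x * y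
*-0≤ {x} {y} 0≤x 0≤y = ℚ.nonNegative⁻¹ (x * y)
  {{ℚ.nonNeg*nonNeg⇒nonNeg x {{nonNegative 0≤x}} y {{nonNegative 0≤y}}}}

*-0< : ∀ {x y} → 0ℚ < x → 0ℚ < y → 0ℚ < x * y
*-0< {x} {y} 0<x 0<y = ℚ.positive⁻¹ (x * y) {{ℚ.pos*pos⇒pos x {{positive 0<x}} y {{positive 0<y}}}}

+-0≤ : ∀ {x y} → 0ℚ ≤ x → 0ℚ ≤ y → 0ℚ ≤ x + y
+-0≤ = ℚ.+-mono-≤

+-0< : ∀ {x y} → 0ℚ < x → 0ℚ ≤ y → 0ℚ < x + y
+-0< = ℚ.+-mono-<-≤

0≤difference : ∀ {x y} → x ≤ y → 0ℚ ≤ y - x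
0≤difference {x} {y} x≤y = subst (_≤ y - x) (ℚ.+-inverseʳ x) (ℚ.+-monoˡ-≤ (- x) x≤y)

0<difference : ∀ {x y} → x < y → 0ℚ < y - x
0<difference {x} {y} x<y = subst (_< y - x) (ℚ.+-inverseʳ x) (ℚ.+-monoˡ-< (- x) x<y)

≤-by-difference : ∀ {x y} d → 0ℚ ≤ d → x + d ≡ y → x ≤ y
≤-by-difference {x} d 0≤d refl = subst (_≤ x + d) (ℚ.+-identityʳ x) (ℚ.+-monoʳ-≤ x 0≤d)

<-by-difference : ∀ {x y} d → 0ℚ < d → x + d ≡ y → x < y
<-by-difference {x} d 0<d refl = subst (_< x + d) (ℚ.+-identityʳ x) (ℚ.+-monoʳ-< x 0<d)

*-monoʳ-≤ : ∀ {x y} z → 0ℚ ≤ z → x ≤ y → x * z ≤ y * z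
*-monoʳ-≤ z 0≤z = ℚ.*-monoʳ-≤-nonNeg z {{nonNegative 0≤z}}

*-monoˡ-≤ : ∀ {x y} z → 0ℚ ≤ z → x ≤ y → z * x ≤ z * y
*-monoˡ-≤ z 0≤z = ℚ.*-monoˡ-≤-nonNeg z {{nonNegative 0≤z}}

*-mono-≤ : ∀ {x y u v} → 0ℚ ≤ u → 0ℚ ≤ y → x ≤ y → u ≤ v → x * u ≤ y * v
*-mono-≤ {y = y} {u} 0≤u 0≤y x≤y u≤v = ℚ.≤-trans (*-monoʳ-≤ u 0≤u x≤y) (*-monoˡ-≤ y 0≤y u≤v)

*-cancelʳ-≤ : ∀ {x y} z → 0ℚ < z → x * z ≤ y * z → x ≤ y
*-cancelʳ-≤ z 0<z = ℚ.*-cancelʳ-≤-pos z {{positive 0<z}}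

*-cancelʳ-0< : ∀ {x} z → 0ℚ < z → 0ℚ < x * z → 0ℚ < x
*-cancelʳ-0< {x} z 0<z 0<xz = ℚ.*-cancelʳ-<-nonNeg z {{nonNegative (ℚ.<⇒≤ 0<z)}}
  (subst (_< x * z) (sym (ℚ.*-zeroˡ z)) 0<xz)

quotient : ∀ n {d} → 0ℚ < d → ∃[ x ] x * d ≡ n
quotient n {d} 0<d = (n ÷ d) {{≢-nonZero d≢0}} , ÷⇒* d≢0 refl
  where
  d≢0 : d ≢ 0ℚ
  d≢0 = ℚ.<⇒≢ 0<d ∘ sym

0<1 : 0ℚ < 1ℚ
0<1 = ℚ.positive⁻¹ 1ℚ

2ℚ : ℚ
2ℚ = 1ℚ + 1ℚ

ℕ→ℚ : ℕ → ℚ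
ℕ→ℚ n = mkℚ (ℤ.+ n) 0 (coprime-sym (1-coprimeTo n))

ℕ→ℚ-suc : ∀ n → ℕ→ℚ (suc n) ≡ 1ℚ + ℕ→ℚ n
ℕ→ℚ-suc n = trans (sym (ℚ.↥p/↧p≡p (ℕ→ℚ (suc n)))) (cong (_/ 1) (cong (λ i → ℤ.+ 1 ℤ.+ i) (sym (ℤ.*-identityʳ (ℤ.+ n)))))

ℕ→ℚ-+ : ∀ m n → ℕ→ℚ (m ℕ.+ n) ≡ ℕ→ℚ m + ℕ→ℚ n
ℕ→ℚ-+ zero    n = sym (ℚ.+-identityˡ (ℕ→ℚ n))
ℕ→ℚ-+ (suc m) n = begin
  ℕ→ℚ (suc (m ℕ.+ n))       ≡⟨ ℕ→ℚ-suc (m ℕ.+ n) ⟩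
  1ℚ + ℕ→ℚ (m ℕ.+ n)        ≡⟨ cong (1ℚ +_) (ℕ→ℚ-+ m n) ⟩
  1ℚ + (ℕ→ℚ m + ℕ→ℚ n)    ≡⟨ ℚ.+-assoc 1ℚ (ℕ→ℚ m) (ℕ→ℚ n) ⟨
  1ℚ + ℕ→ℚ m + ℕ→ℚ n      ≡⟨ cong (_+ ℕ→ℚ n) (ℕ→ℚ-suc m) ⟨
  ℕ→ℚ (suc m) + ℕ→ℚ n     ∎
  where open ≡-Reasoning

ℕ→ℚ-mono-≤ : ∀ {m n} → m ℕ.≤ n → ℕ→ℚ m ≤ ℕ→ℚ n
ℕ→ℚ-mono-≤ m≤n = *≤* (ℤ.*-monoʳ-≤-nonNeg (ℤ.+ 1) (ℤ.+≤+ m≤n))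

ℕ→ℚ-2^ : ∀ n → ℕ→ℚ (2 ℕ.^ n) ≡ 2ℚ ^ℚ n
ℕ→ℚ-2^ zero    = refl
ℕ→ℚ-2^ (suc n) = begin
  ℕ→ℚ (2 ℕ.^ n ℕ.+ (2 ℕ.^ n ℕ.+ 0))        ≡⟨ cong (λ m → ℕ→ℚ (2 ℕ.^ n ℕ.+ m)) (ℕ.+-identityʳ (2 ℕ.^ n)) ⟩
  ℕ→ℚ (2 ℕ.^ n ℕ.+ 2 ℕ.^ n)                ≡⟨ ℕ→ℚ-+ (2 ℕ.^ n) (2 ℕ.^ n) ⟩
  ℕ→ℚ (2 ℕ.^ n) + ℕ→ℚ (2 ℕ.^ n)          ≡⟨ solve 1 (λ x → x :+ x := (con 1ℚ :+ con 1ℚ) :* x) refl (ℕ→ℚ (2 ℕ.^ n)) ⟩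
  2ℚ * ℕ→ℚ (2 ℕ.^ n)                       ≡⟨ cong (2ℚ *_) (ℕ→ℚ-2^ n) ⟩
  2ℚ * 2ℚ ^ℚ n                               ∎
  where open ≡-Reasoning

i≤+∣i∣ : ∀ i → i ℤ.≤ ℤ.+ ∣ i ∣
i≤+∣i∣ (ℤ.+ n)    = ℤ.≤-refl
i≤+∣i∣ -[1+ n ] = ℤ.-≤+

-- The hypothesis says that p ≤ i.
≤ℕ→ℚ∣∣ : ∀ p i → ↥ p ℤ.≤ i ℤ.* ↧ p → p ≤ ℕ→ℚ ∣ i ∣
≤ℕ→ℚ∣∣ p@record{} i p≤i = *≤* (begin
  ↥ p ℤ.* ℤ.+ 1     ≡⟨ ℤ.*-identityʳ (↥ p) ⟩
  ↥ p             ≤⟨ p≤i ⟩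
  i ℤ.* ↧ p       ≤⟨ ℤ.*-monoʳ-≤-nonNeg (↧ p) (i≤+∣i∣ i) ⟩
  ℤ.+ ∣ i ∣ ℤ.* ↧ p ∎)
  where open ℤ.≤-Reasoning

≤-ceiling : ∀ p → ↥ p ℤ.≤ ⌈ p ⌉ ℤ.* ↧ p
≤-ceiling p@record{} = begin
  ↥ p                             ≡⟨ ℤ.neg-involutive (↥ p) ⟨
  ℤ.- (ℤ.- ↥ p)                   ≡⟨ cong ℤ.-_ (ℚ.↥-neg p) ⟨
  ℤ.- ↥ (- p)                     ≤⟨ ℤ.neg-mono-≤ (floor-≤ (- p)) ⟩
  ℤ.- (⌊ - p ⌋ ℤ.* ↧ (- p))       ≡⟨ ℤ.neg-distribˡ-* ⌊ - p ⌋ (↧ (- p)) ⟩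
  ⌈ p ⌉ ℤ.* ↧ (- p)               ≡⟨ cong (⌈ p ⌉ ℤ.*_) (ℚ.↧-neg p) ⟩
  ⌈ p ⌉ ℤ.* ↧ p                   ∎
  where
  open ℤ.≤-Reasoning
  floor-≤ : ∀ r → ⌊ r ⌋ ℤ.* ↧ r ℤ.≤ ↥ r
  floor-≤ r@record{} = ℤ.[n/d]*d≤n (↥ r) (↧ r)

^-0≤ : ∀ {x} → 0ℚ ≤ x → ∀ n → 0ℚ ≤ x ^ℚ n
^-0≤ 0≤x zero    = ℚ.<⇒≤ 0<1
^-0≤ 0≤x (suc n) = *-0≤ 0≤x (^-0≤ 0≤x n)

^-mono-≤ : ∀ {x y} → 0ℚ ≤ x → x ≤ y → ∀ n → x ^ℚ n ≤ y ^ℚ n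
^-mono-≤ 0≤x x≤y zero    = ℚ.≤-refl
^-mono-≤ 0≤x x≤y (suc n) = *-mono-≤ (^-0≤ 0≤x n) (ℚ.≤-trans 0≤x x≤y) x≤y (^-mono-≤ 0≤x x≤y n)

module _ {δ} (0<δ : 0ℚ < δ) where

  bernoulli : ∀ n → 1ℚ + ℕ→ℚ n * δ ≤ (1ℚ + δ) ^ℚ n
  bernoulli zero    = ≤-by-difference 0ℚ ℚ.≤-refl (solve 1 (λ δ → con 1ℚ :+ con 0ℚ :* δ :+ con 0ℚ := con 1ℚ) refl δ)
  bernoulli (suc n) = begin
    1ℚ + ℕ→ℚ (suc n) * δ
      ≡⟨ cong (λ m → 1ℚ + m * δ) (ℕ→ℚ-suc n) ⟩
    1ℚ + (1ℚ + ℕ→ℚ n) * δ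
      ≤⟨ ≤-by-difference (ℕ→ℚ n * δ * δ) (*-0≤ (*-0≤ (ℕ→ℚ-mono-≤ ℕ.z≤n) 0≤δ) 0≤δ)
           (solve 2 (λ n δ → con 1ℚ :+ (con 1ℚ :+ n) :* δ :+ n :* δ :* δ := (con 1ℚ :+ δ) :* (con 1ℚ :+ n :* δ)) refl (ℕ→ℚ n) δ) ⟩
    (1ℚ + δ) * (1ℚ + ℕ→ℚ n * δ)
      ≤⟨ *-monoˡ-≤ (1ℚ + δ) (+-0≤ (ℚ.<⇒≤ 0<1) 0≤δ) (bernoulli n) ⟩
    (1ℚ + δ) * (1ℚ + δ) ^ℚ n ∎
    where
    open ℚ.≤-Reasoning
    0≤δ = ℚ.<⇒≤ 0<δ

  ^-unbounded : ∀ r → ∃[ n ] r ≤ (1ℚ + δ) ^ℚ n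
  ^-unbounded r with quotient r 0<δ
  ... | x , refl = n , (begin
    x * δ              ≤⟨ *-monoʳ-≤ δ (ℚ.<⇒≤ 0<δ) x≤n ⟩
    ℕ→ℚ n * δ        ≤⟨ ≤-by-difference 1ℚ (ℚ.<⇒≤ 0<1) (ℚ.+-comm (ℕ→ℚ n * δ) 1ℚ) ⟩
    1ℚ + ℕ→ℚ n * δ   ≤⟨ bernoulli n ⟩
    (1ℚ + δ) ^ℚ n      ∎)
    where
    open ℚ.≤-Reasoning
    n = ∣ ⌈ x ⌉ ∣
    x≤n : x ≤ ℕ→ℚ n
    x≤n = ≤ℕ→ℚ∣∣ x ⌈ x ⌉ (≤-ceiling x)

^-^ : ∀ x m n → (x ^ℚ m) ^ℚ n ≡ x ^ℚ (m ℕ.* n)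
^-^ x m n = trans (×-assocˡ ℚ.*-1-monoid x n m) (cong (x ^ℚ_) (ℕ.*-comm n m))

n≤2^⌈log2⌉n : ∀ n (rs : Acc ℕ._<_ n) → n ℕ.≤ 2 ℕ.^ ⌈log2⌉ n rs
n≤2^⌈log2⌉n zero          _        = ℕ.z≤n
n≤2^⌈log2⌉n (suc zero)    _        = ℕ.s≤s ℕ.z≤n
n≤2^⌈log2⌉n (suc (suc n)) (acc rs) = begin
  2 ℕ.+ n                      ≡⟨ cong (2 ℕ.+_) (ℕ.⌊n/2⌋+⌈n/2⌉≡n n) ⟨
  2 ℕ.+ (⌊ n /2⌋ ℕ.+ ⌈ n /2⌉)  ≤⟨ ℕ.+-monoʳ-≤ 2 (ℕ.+-monoˡ-≤ ⌈ n /2⌉ (ℕ.⌊n/2⌋≤⌈n/2⌉ n)) ⟩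
  2 ℕ.+ (⌈ n /2⌉ ℕ.+ ⌈ n /2⌉)  ≡⟨ cong suc (ℕ.+-suc ⌈ n /2⌉ ⌈ n /2⌉) ⟨
  suc ⌈ n /2⌉ ℕ.+ suc ⌈ n /2⌉  ≡⟨ cong (suc ⌈ n /2⌉ ℕ.+_) (ℕ.+-identityʳ (suc ⌈ n /2⌉)) ⟨
  2 ℕ.* suc ⌈ n /2⌉            ≤⟨ ℕ.*-monoʳ-≤ 2 (n≤2^⌈log2⌉n (suc ⌈ n /2⌉) _) ⟩
  2 ℕ.^ ⌈log2⌉ (suc (suc n)) (acc rs) ∎
  where open ℕ.≤-Reasoning

1≤2^⌈log₂1/⌉* : ∀ π .{{_ : Positive π}} → 1ℚ ≤ 2ℚ ^ℚ ⌈log₂1/ π ⌉ * π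
1≤2^⌈log₂1/⌉* π = begin
  1ℚ                               ≡⟨ ℚ.*-inverseˡ π ⟨
  1/ π * π                         ≤⟨ *-monoʳ-≤ π (ℚ.<⇒≤ (ℚ.positive⁻¹ π)) bound ⟩
  2ℚ ^ℚ ⌈log₂1/ π ⌉ * π            ∎
  where
  open ℚ.≤-Reasoning
  instance
    π-nonZero : NonZero π
    π-nonZero = ℚ.pos⇒nonZero π
  n = ∣ ⌈ 1/ π ⌉ ∣
  bound : 1/ π ≤ 2ℚ ^ℚ ⌈log₂1/ π ⌉
  bound = ℚ.≤-trans (≤ℕ→ℚ∣∣ (1/ π) ⌈ 1/ π ⌉ (≤-ceiling (1/ π)))
    (ℚ.≤-trans (ℕ→ℚ-mono-≤ (n≤2^⌈log2⌉n n _)) (ℚ.≤-reflexive (ℕ→ℚ-2^ ⌈log₂ n ⌉)))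

-- Approximating a weight

module _ {q α : ℚ} where

  bundle : ∀ {j δ} → Realisable q α j δ → ∀ n → ∃[ k ] Realisable q α k ((1ℚ + δ) ^ℚ suc n - 1ℚ)
  bundle {j} {δ} r zero = j , subst (Realisable q α j)
    (solve 1 (λ δ → δ := (con 1ℚ :+ δ) :* con 1ℚ :- con 1ℚ) refl δ) r
  bundle {j} {δ} r (suc n) with bundle r n
  ... | k , rs = j ℕ.+ k , parallel r rs
    (solve 2 (λ δ p → con 1ℚ :+ ((con 1ℚ :+ δ) :* p :- con 1ℚ) := (con 1ℚ :+ δ) :* (con 1ℚ :+ (p :- con 1ℚ)))
      refl δ ((1ℚ + δ) ^ℚ suc n))

  module Search {w₀ ρ : ℚ} {k : ℕ} (r : Realisable q α k w₀)
    (1≤q : 1ℚ ≤ q) (q²≤w₀ : q * q ≤ w₀) (ρw₀ : ρ * w₀ ≡ w₀ + q) where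

    private
      0<q : 0ℚ < q
      0<q = ℚ.<-≤-trans 0<1 1≤q
      0<w₀ : 0ℚ < w₀
      0<w₀ = ℚ.<-≤-trans (*-0< 0<q 0<q) q²≤w₀
      0≤q = ℚ.<⇒≤ 0<q
      0≤w₀ = ℚ.<⇒≤ 0<w₀
      0<1+w₀ : 0ℚ < 1ℚ + w₀
      0<1+w₀ = +-0< {1ℚ} {w₀} 0<1 0≤w₀
      0≤1+w₀ = ℚ.<⇒≤ 0<1+w₀
      0<ρ : 0ℚ < ρ
      0<ρ = *-cancelʳ-0< w₀ 0<w₀ (subst (0ℚ <_) (sym ρw₀) (+-0< 0<w₀ 0≤q))

    -- In the coordinate x / (x + q), the interval [L , U] has length at least ρ⁻ⁿ.
    Wide : ℕ → ℚ → ℚ → Set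
    Wide n L U = (L + q) * (U + q) ≤ ρ ^ℚ n * (q * (U - L))

    -- x ↦ (1 + x)(1 + w₀) − 1 maps L′ and U′ to L and U.
    wide-parallel : ∀ n {L U L′ U′} → 0ℚ ≤ L′ → L′ ≤ U′ →
      L ≡ L′ * (1ℚ + w₀) + w₀ → U ≡ U′ * (1ℚ + w₀) + w₀ → Wide (suc n) L U → Wide n L′ U′
    wide-parallel n {_} {_} {L} {U} 0≤L L≤U refl refl wide =
      *-cancelʳ-≤ (w₀ * (K * K)) (*-0< 0<w₀ (*-0< 0<K 0<K)) (begin
        (L + q) * (U + q) * (w₀ * (K * K))
          ≡⟨ solve 5 (λ L U q w₀ K → (L :+ q) :* (U :+ q) :* (w₀ :* (K :* K)) :=
               w₀ :* ((K :* (L :+ q)) :* (K :* (U :+ q)))) refl L U q w₀ K ⟩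
        w₀ * ((K * (L + q)) * (K * (U + q)))
          ≤⟨ *-monoˡ-≤ w₀ 0≤w₀ (*-mono-≤ (*-0≤ 0≤K (+-0≤ 0≤U 0≤q)) (*-0≤ 0≤q (+-0≤ (+-0≤ (*-0≤ 0≤L 0≤1+w₀) 0≤w₀) 0≤q))
               (stretch 0≤L) (stretch 0≤U)) ⟩
        w₀ * ((q * (L * (1ℚ + w₀) + w₀ + q)) * (q * (U * (1ℚ + w₀) + w₀ + q)))
          ≡⟨ solve 4 (λ w₀ q x y → w₀ :* ((q :* x) :* (q :* y)) := w₀ :* (q :* q) :* (x :* y)) refl
               w₀ q (L * (1ℚ + w₀) + w₀ + q) (U * (1ℚ + w₀) + w₀ + q) ⟩
        w₀ * (q * q) * ((L * (1ℚ + w₀) + w₀ + q) * (U * (1ℚ + w₀) + w₀ + q))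
          ≤⟨ *-monoˡ-≤ (w₀ * (q * q)) (*-0≤ 0≤w₀ (*-0≤ 0≤q 0≤q)) wide ⟩
        w₀ * (q * q) * (ρ * ρ ^ℚ n * (q * (U * (1ℚ + w₀) + w₀ - (L * (1ℚ + w₀) + w₀))))
          ≡⟨ solve 6 (λ w₀ q ρ p U L →
               w₀ :* (q :* q) :* (ρ :* p :* (q :* (U :* (con 1ℚ :+ w₀) :+ w₀ :- (L :* (con 1ℚ :+ w₀) :+ w₀)))) :=
               p :* (q :* (U :- L)) :* (q :* q :* (con 1ℚ :+ w₀) :* (ρ :* w₀))) refl w₀ q ρ (ρ ^ℚ n) U L ⟩
        ρ ^ℚ n * (q * (U - L)) * (q * q * (1ℚ + w₀) * (ρ * w₀))
          ≡⟨ cong (λ x → ρ ^ℚ n * (q * (U - L)) * (q * q * (1ℚ + w₀) * x)) ρw₀ ⟩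
        ρ ^ℚ n * (q * (U - L)) * (q * q * (1ℚ + w₀) * K)
          ≤⟨ *-monoˡ-≤ (ρ ^ℚ n * (q * (U - L))) (*-0≤ (^-0≤ (ℚ.<⇒≤ 0<ρ) n) (*-0≤ 0≤q (0≤difference L≤U)))
               (ℚ.≤-trans (*-monoʳ-≤ K 0≤K scale) (ℚ.≤-reflexive (ℚ.*-assoc w₀ K K))) ⟩
        ρ ^ℚ n * (q * (U - L)) * (w₀ * (K * K)) ∎)
      where
      open ℚ.≤-Reasoning
      K : ℚ
      K = w₀ + q
      0<K : 0ℚ < K
      0<K = +-0< 0<w₀ 0≤q
      0≤K = ℚ.<⇒≤ 0<K
      0≤U = ℚ.≤-trans 0≤L L≤U

      stretch : ∀ {x} → 0ℚ ≤ x → K * (x + q) ≤ q * (x * (1ℚ + w₀) + w₀ + q)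
      stretch {x} 0≤x = ≤-by-difference (x * (w₀ * (q - 1ℚ))) (*-0≤ 0≤x (*-0≤ 0≤w₀ (0≤difference 1≤q)))
        (solve 3 (λ x w₀ q → (w₀ :+ q) :* (x :+ q) :+ x :* (w₀ :* (q :- con 1ℚ)) :=
          q :* (x :* (con 1ℚ :+ w₀) :+ w₀ :+ q)) refl x w₀ q)

      scale : q * q * (1ℚ + w₀) ≤ w₀ * K
      scale = ≤-by-difference (w₀ * (w₀ - q * q) + q * (w₀ - q * q) + q * q * (q - 1ℚ))
        (+-0≤ (+-0≤ (*-0≤ 0≤w₀ (0≤difference q²≤w₀)) (*-0≤ 0≤q (0≤difference q²≤w₀)))
          (*-0≤ (*-0≤ 0≤q 0≤q) (0≤difference 1≤q)))
        (solve 2 (λ w₀ q → q :* q :* (con 1ℚ :+ w₀) :+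
          (w₀ :* (w₀ :- q :* q) :+ q :* (w₀ :- q :* q) :+ q :* q :* (q :- con 1ℚ)) := w₀ :* (w₀ :+ q)) refl w₀ q)

    -- x ↦ x w₀ / (q + x + w₀) maps L′ and U′ to L and U.
    module _ {L U L′ U′} (L<w₀ : L < w₀) (U<w₀ : U < w₀)
      (L′≡ : L′ * (w₀ - L) ≡ L * (q + w₀)) (U′≡ : U′ * (w₀ - U) ≡ U * (q + w₀)) where

      private
        D : ℚ
        D = (w₀ - L) * (w₀ - U)
        0<D : 0ℚ < D
        0<D = *-0< (0<difference L<w₀) (0<difference U<w₀)

        difference : (U′ - L′) * D ≡ (q + w₀) * w₀ * (U - L)
        difference = begin
          (U′ - L′) * D
            ≡⟨ solve 4 (λ L′ U′ a b → (U′ :- L′) :* (a :* b) := (U′ :* b) :* a :- (L′ :* a) :* b) refl L′ U′ (w₀ - L) (w₀ - U) ⟩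
          (U′ * (w₀ - U)) * (w₀ - L) - (L′ * (w₀ - L)) * (w₀ - U)
            ≡⟨ cong₂ (λ x y → x * (w₀ - L) - y * (w₀ - U)) U′≡ L′≡ ⟩
          (U * (q + w₀)) * (w₀ - L) - (L * (q + w₀)) * (w₀ - U)
            ≡⟨ solve 4 (λ L U q w₀ → (U :* (q :+ w₀)) :* (w₀ :- L) :- (L :* (q :+ w₀)) :* (w₀ :- U) :=
                 (q :+ w₀) :* w₀ :* (U :- L)) refl L U q w₀ ⟩
          (q + w₀) * w₀ * (U - L) ∎
          where open ≡-Reasoning

        shift : ∀ {x x′} → x′ * (w₀ - x) ≡ x * (q + w₀) → (x′ + q) * (w₀ - x) ≡ w₀ * (x + q)
        shift {x} {x′} eq = begin
          (x′ + q) * (w₀ - x)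
            ≡⟨ ℚ.*-distribʳ-+ (w₀ - x) x′ q ⟩
          x′ * (w₀ - x) + q * (w₀ - x)
            ≡⟨ cong (_+ q * (w₀ - x)) eq ⟩
          x * (q + w₀) + q * (w₀ - x)
            ≡⟨ solve 3 (λ x q w₀ → x :* (q :+ w₀) :+ q :* (w₀ :- x) := w₀ :* (x :+ q)) refl x q w₀ ⟩
          w₀ * (x + q) ∎
          where open ≡-Reasoning

      series-mono : L ≤ U → L′ ≤ U′
      series-mono L≤U = *-cancelʳ-≤ D 0<D (≤-by-difference ((q + w₀) * w₀ * (U - L))
        (*-0≤ (*-0≤ (+-0≤ 0≤q 0≤w₀) 0≤w₀) (0≤difference L≤U))
        (trans (cong (L′ * D +_) (sym difference))
          (solve 3 (λ L′ U′ D → L′ :* D :+ (U′ :- L′) :* D := U′ :* D) refl L′ U′ D)))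

      wide-series : ∀ n → Wide (suc n) L U → Wide n L′ U′
      wide-series n wide = *-cancelʳ-≤ D 0<D (begin
        (L′ + q) * (U′ + q) * D
          ≡⟨ solve 4 (λ x y a b → x :* y :* (a :* b) := (x :* a) :* (y :* b)) refl (L′ + q) (U′ + q) (w₀ - L) (w₀ - U) ⟩
        ((L′ + q) * (w₀ - L)) * ((U′ + q) * (w₀ - U))
          ≡⟨ cong₂ _*_ (shift {L} {L′} L′≡) (shift {U} {U′} U′≡) ⟩
        (w₀ * (L + q)) * (w₀ * (U + q))
          ≡⟨ solve 3 (λ w₀ x y → (w₀ :* x) :* (w₀ :* y) := w₀ :* w₀ :* (x :* y)) refl w₀ (L + q) (U + q) ⟩
        w₀ * w₀ * ((L + q) * (U + q))
          ≤⟨ *-monoˡ-≤ (w₀ * w₀) (*-0≤ 0≤w₀ 0≤w₀) wide ⟩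
        w₀ * w₀ * (ρ * ρ ^ℚ n * (q * (U - L)))
          ≡⟨ solve 5 (λ w₀ ρ p q d → w₀ :* w₀ :* (ρ :* p :* (q :* d)) := p :* (q :* (ρ :* w₀ :* w₀ :* d))) refl w₀ ρ (ρ ^ℚ n) q (U - L) ⟩
        ρ ^ℚ n * (q * (ρ * w₀ * w₀ * (U - L)))
          ≡⟨ cong (λ x → ρ ^ℚ n * (q * (x * w₀ * (U - L)))) (trans ρw₀ (ℚ.+-comm w₀ q)) ⟩
        ρ ^ℚ n * (q * ((q + w₀) * w₀ * (U - L)))
          ≡⟨ cong (λ x → ρ ^ℚ n * (q * x)) difference ⟨
        ρ ^ℚ n * (q * ((U′ - L′) * D))
          ≡⟨ solve 4 (λ p q d D → p :* (q :* (d :* D)) := p :* (q :* d) :* D) refl (ρ ^ℚ n) q (U′ - L′) D ⟩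
        ρ ^ℚ n * (q * (U′ - L′)) * D ∎)
        where open ℚ.≤-Reasoning

    ¬wide₀ : ∀ {L U} → 0ℚ < L → L ≤ U → ¬ Wide 0 L U
    ¬wide₀ {L} {U} 0<L L≤U wide = ℚ.<-irrefl refl (ℚ.<-≤-trans (<-by-difference (q * q + (L * U + (q * L + q * L)))
      (+-0< (*-0< 0<q 0<q) (+-0≤ (*-0≤ 0≤L 0≤U) (+-0≤ (*-0≤ 0≤q 0≤L) (*-0≤ 0≤q 0≤L))))
      (solve 3 (λ L U q → con 1ℚ :* (q :* (U :- L)) :+ (q :* q :+ (L :* U :+ (q :* L :+ q :* L))) :=
        (L :+ q) :* (U :+ q)) refl L U q)) wide)
      where
      0≤L = ℚ.<⇒≤ 0<L
      0≤U = ℚ.≤-trans 0≤L L≤U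

    Found : ℕ → ℚ → ℚ → Set
    Found n L U = ∃[ w ] L ≤ w × w ≤ U × ∃[ m ] m ℕ.≤ suc n ℕ.* k × Realisable q α m w

    Searchable : ℕ → Set
    Searchable n = ∀ L U → 0ℚ < L → L ≤ U → Wide n L U → Found n L U

    search-parallel : ∀ n L U → Searchable n → w₀ < L → L ≤ U → Wide (suc n) L U → Found (suc n) L U
    search-parallel n L U search w₀<L L≤U wide =
      pull (quotient (L - w₀) 0<1+w₀) (quotient (U - w₀) 0<1+w₀)
      where
      restore : ∀ x x′ → x′ * (1ℚ + w₀) ≡ x - w₀ → x ≡ x′ * (1ℚ + w₀) + w₀
      restore x x′ eq = trans (solve 2 (λ x w₀ → x := x :- w₀ :+ w₀) refl x w₀) (cong (_+ w₀) (sym eq))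

      law : ∀ w → 1ℚ + (w * (1ℚ + w₀) + w₀) ≡ (1ℚ + w₀) * (1ℚ + w)
      law w = solve 2 (λ w w₀ → con 1ℚ :+ (w :* (con 1ℚ :+ w₀) :+ w₀) := (con 1ℚ :+ w₀) :* (con 1ℚ :+ w)) refl w w₀

      pull : ∃[ L′ ] L′ * (1ℚ + w₀) ≡ L - w₀ → ∃[ U′ ] U′ * (1ℚ + w₀) ≡ U - w₀ → Found (suc n) L U
      pull (L′ , L′≡) (U′ , U′≡) = push (search L′ U′ 0<L′ L′≤U′
        (wide-parallel n {L} {U} {L′} {U′} (ℚ.<⇒≤ 0<L′) L′≤U′ (restore L L′ L′≡) (restore U U′ U′≡) wide))
        where
        0<L′ : 0ℚ < L′
        0<L′ = *-cancelʳ-0< (1ℚ + w₀) 0<1+w₀ (subst (0ℚ <_) (sym L′≡) (0<difference w₀<L))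

        L′≤U′ : L′ ≤ U′
        L′≤U′ = *-cancelʳ-≤ (1ℚ + w₀) 0<1+w₀ (subst₂ _≤_ (sym L′≡) (sym U′≡) (ℚ.+-monoˡ-≤ (- w₀) L≤U))

        push : Found n L′ U′ → Found (suc n) L U
        push (w , L′≤w , w≤U′ , m , m≤ , rw) =
          w * (1ℚ + w₀) + w₀ ,
          subst (_≤ w * (1ℚ + w₀) + w₀) (sym (restore L L′ L′≡)) (ℚ.+-monoˡ-≤ w₀ (*-monoʳ-≤ (1ℚ + w₀) 0≤1+w₀ L′≤w)) ,
          subst (w * (1ℚ + w₀) + w₀ ≤_) (sym (restore U U′ U′≡)) (ℚ.+-monoˡ-≤ w₀ (*-monoʳ-≤ (1ℚ + w₀) 0≤1+w₀ w≤U′)) ,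
          k ℕ.+ m , ℕ.+-monoʳ-≤ k m≤ , parallel r rw (law w)

    search-series : ∀ n L U → Searchable n → U < w₀ → 0ℚ < L → L ≤ U → Wide (suc n) L U → Found (suc n) L U
    search-series n L U search U<w₀ 0<L L≤U wide =
      pull (quotient (L * (q + w₀)) (0<difference L<w₀)) (quotient (U * (q + w₀)) (0<difference U<w₀))
      where
      L<w₀ : L < w₀
      L<w₀ = ℚ.≤-<-trans L≤U U<w₀

      compare : ∀ w x x′ → x′ * (w₀ - x) ≡ x * (q + w₀) →
                x * (q + w₀ + w) + (w - x′) * (w₀ - x) ≡ w₀ * w
      compare w x x′ eq = begin
        x * (q + w₀ + w) + (w - x′) * (w₀ - x)
          ≡⟨ solve 5 (λ x x′ q w₀ w → x :* (q :+ w₀ :+ w) :+ (w :- x′) :* (w₀ :- x) :=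
               w₀ :* w :+ x :* (q :+ w₀) :- x′ :* (w₀ :- x)) refl x x′ q w₀ w ⟩
        w₀ * w + x * (q + w₀) - x′ * (w₀ - x)
          ≡⟨ cong (λ y → w₀ * w + x * (q + w₀) - y) eq ⟩
        w₀ * w + x * (q + w₀) - x * (q + w₀)
          ≡⟨ solve 2 (λ a b → a :+ b :- b := a) refl (w₀ * w) (x * (q + w₀)) ⟩
        w₀ * w ∎
        where open ≡-Reasoning

      pull : ∃[ L′ ] L′ * (w₀ - L) ≡ L * (q + w₀) → ∃[ U′ ] U′ * (w₀ - U) ≡ U * (q + w₀) → Found (suc n) L U
      pull (L′ , L′≡) (U′ , U′≡) = push (search L′ U′ 0<L′ (series-mono {L} {U} {L′} {U′} L<w₀ U<w₀ L′≡ U′≡ L≤U)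
        (wide-series {L} {U} {L′} {U′} L<w₀ U<w₀ L′≡ U′≡ n wide))
        where
        0<L′ : 0ℚ < L′
        0<L′ = *-cancelʳ-0< (w₀ - L) (0<difference L<w₀) (subst (0ℚ <_) (sym L′≡) (*-0< 0<L (+-0< 0<q 0≤w₀)))

        push : Found n L′ U′ → Found (suc n) L U
        push (w , L′≤w , w≤U′ , m , m≤ , rw) = finish (quotient (w₀ * w) 0<sum)
          where
          0<sum : 0ℚ < q + w₀ + w
          0<sum = +-0< (+-0< 0<q 0≤w₀) (ℚ.≤-trans (ℚ.<⇒≤ 0<L′) L′≤w)

          finish : ∃[ v ] v * (q + w₀ + w) ≡ w₀ * w → Found (suc n) L U
          finish (v , v≡) = v ,
            *-cancelʳ-≤ (q + w₀ + w) 0<sum (≤-by-difference ((w - L′) * (w₀ - L))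
              (*-0≤ (0≤difference L′≤w) (0≤difference (ℚ.<⇒≤ L<w₀)))
              (trans (compare w L L′ L′≡) (sym v≡))) ,
            *-cancelʳ-≤ (q + w₀ + w) 0<sum (≤-by-difference ((U′ - w) * (w₀ - U))
              (*-0≤ (0≤difference w≤U′) (0≤difference (ℚ.<⇒≤ U<w₀)))
              (trans (cong (_+ (U′ - w) * (w₀ - U)) (trans v≡ (sym (compare w U U′ U′≡))))
                (solve 4 (λ a U′ w b → a :+ (w :- U′) :* b :+ (U′ :- w) :* b := a) refl (U * (q + w₀ + w)) U′ w (w₀ - U)))) ,
            k ℕ.+ m , ℕ.+-monoʳ-≤ k m≤ , series r rw (ℚ.<⇒≢ 0<sum ∘ sym) v≡

    search : ∀ n → Searchable n
    search n L U 0<L L≤U wide with U ℚ.<? w₀ | w₀ ℚ.<? L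
    search n       L U 0<L L≤U wide | no U≮w₀  | no w₀≮L  =
      w₀ , ℚ.≮⇒≥ w₀≮L , ℚ.≮⇒≥ U≮w₀ , k , ℕ.m≤m+n k (n ℕ.* k) , r
    search zero    L U 0<L L≤U wide | yes _    | _        = contradiction wide (¬wide₀ 0<L L≤U)
    search zero    L U 0<L L≤U wide | no _     | yes _    = contradiction wide (¬wide₀ 0<L L≤U)
    search (suc n) L U 0<L L≤U wide | yes U<w₀ | _        = search-series n L U (search n) U<w₀ 0<L L≤U wide
    search (suc n) L U 0<L L≤U wide | no _     | yes w₀<L = search-parallel n L U (search n) w₀<L L≤U wide

0<α[α+2] : ∀ {α} → ¬ (- 2ℚ ≤ α × α ≤ 0ℚ) → 0ℚ < α * (α + 2ℚ)
0<α[α+2] {α} α∉ with α ℚ.≤? 0ℚ | - 2ℚ ℚ.≤? α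
... | yes α≤0 | yes -2≤α = contradiction (-2≤α , α≤0) α∉
... | no α≰0  | _ = *-0< 0<α (+-0< 0<α (ℚ.<⇒≤ (+-0< 0<1 (ℚ.<⇒≤ 0<1))))
  where
  0<α = ℚ.≰⇒> α≰0
... | yes α≤0 | no -2≰α = subst (0ℚ <_)
  (solve 1 (λ α → (con (- 2ℚ) :- α) :* (con 0ℚ :- α) := α :* (α :+ con 2ℚ)) refl α)
  (*-0< 0<-2-α (<-by-difference (- 2ℚ - α + 1ℚ + 1ℚ) (+-0< (+-0< 0<-2-α (ℚ.<⇒≤ 0<1)) (ℚ.<⇒≤ 0<1))
    (solve 1 (λ α → con 0ℚ :+ (con (- 2ℚ) :- α :+ con 1ℚ :+ con 1ℚ) := con 0ℚ :- α) refl α)))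
  where
  0<-2-α : 0ℚ < - 2ℚ - α
  0<-2-α = 0<difference (ℚ.≰⇒> -2≰α)

large-bundle : ∀ {q α} → ¬ (- 2ℚ ≤ α × α ≤ 0ℚ) → ∀ x → ∃[ w ] x ≤ w × ∃[ k ] Realisable q α k w
large-bundle {q} {α} α∉ x with ^-unbounded (0<α[α+2] α∉) (1ℚ + x)
... | n , 1+x≤ = w , x≤w , bundle pair n
  where
  δ = α * (α + 2ℚ)
  0<δ : 0ℚ < δ
  0<δ = 0<α[α+2] α∉
  p = (1ℚ + δ) ^ℚ n
  w = (1ℚ + δ) ^ℚ suc n - 1ℚ
  pair : Realisable q α 2 δ
  pair = parallel edge edge
    (solve 1 (λ α → con 1ℚ :+ α :* (α :+ con 2ℚ) := (con 1ℚ :+ α) :* (con 1ℚ :+ α)) refl α)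
  x≤w : x ≤ w
  x≤w = ≤-by-difference ((p - (1ℚ + x)) + δ * p)
    (+-0≤ (0≤difference 1+x≤) (*-0≤ (ℚ.<⇒≤ 0<δ) (^-0≤ (+-0≤ (ℚ.<⇒≤ 0<1) (ℚ.<⇒≤ 0<δ)) n)))
    (solve 3 (λ x p δ → x :+ ((p :- (con 1ℚ :+ x)) :+ δ :* p) := (con 1ℚ :+ δ) :* p :- con 1ℚ) refl x p δ)

Approximable : ℚ → List ℚ → ℚ → List ℕ → Set
Approximable q αs T⁺ p = ∀ T π .{{_ : Positive π}} → π < T → T ≤ T⁺ →
  Σ[ Υ ∈ TwoTerminalPlanarGraph ] Σ[ ŵ ∈ (TwoTerminalPlanarGraph.E Υ → ℚ) ] Σ[ w ∈ ℚ ]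
    (∀ e → ŵ e ∈ αs) × Implements q Υ ŵ w × T - π ≤ w × w ≤ T ×
    TwoTerminalPlanarGraph.size Υ ℕ.≤ ⟦ p ⟧ ⌈log₂1/ π ⌉

module _ {q α w₀ : ℚ} {k : ℕ} (r : Realisable q α k w₀) (1≤q : 1ℚ ≤ q) (q²≤w₀ : q * q ≤ w₀)
  (T⁺ : ℚ) where

  private
    0<q : 0ℚ < q
    0<q = ℚ.<-≤-trans 0<1 1≤q
    0≤q = ℚ.<⇒≤ 0<q

    0<w₀ : 0ℚ < w₀
    0<w₀ = ℚ.<-≤-trans (*-0< 0<q 0<q) q²≤w₀

    δ : ℚ
    δ = proj₁ (quotient q 0<w₀)

    0<δ : 0ℚ < δ
    0<δ = *-cancelʳ-0< w₀ 0<w₀ (subst (0ℚ <_) (sym (proj₂ (quotient q 0<w₀))) 0<q)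

    ρ : ℚ
    ρ = 1ℚ + δ

    ρw₀ : ρ * w₀ ≡ w₀ + q
    ρw₀ = trans (ℚ.*-distribʳ-+ w₀ 1ℚ δ) (cong₂ _+_ (ℚ.*-identityˡ w₀) (proj₂ (quotient q 0<w₀)))

    M D : ℕ
    M = proj₁ (^-unbounded 0<δ 2ℚ)
    D = proj₁ (^-unbounded 0<1 ((T⁺ + q) * (T⁺ + q)))

    0≤2 : 0ℚ ≤ 2ℚ
    0≤2 = +-0≤ (ℚ.<⇒≤ 0<1) (ℚ.<⇒≤ 0<1)

  steps : ℕ → ℕ
  steps ℓ = M ℕ.* (D ℕ.+ ℓ)

  open Search {ρ = ρ} r 1≤q q²≤w₀ ρw₀

  initially-wide : ∀ T π ℓ → 0ℚ < T - π → T ≤ T⁺ → 0ℚ < π → 1ℚ ≤ 2ℚ ^ℚ ℓ * π → Wide (steps ℓ) (T - π) T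
  initially-wide T π ℓ 0<T-π T≤T⁺ 0<π 1≤ = begin
    (T - π + q) * (T + q)
      ≤⟨ *-mono-≤ (+-0≤ 0≤T 0≤q) 0≤T⁺+q (ℚ.+-monoˡ-≤ q (ℚ.≤-trans T-π≤T T≤T⁺)) (ℚ.+-monoˡ-≤ q T≤T⁺) ⟩
    (T⁺ + q) * (T⁺ + q)
      ≤⟨ proj₂ (^-unbounded 0<1 ((T⁺ + q) * (T⁺ + q))) ⟩
    2ℚ ^ℚ D
      ≡⟨ ℚ.*-identityʳ (2ℚ ^ℚ D) ⟨
    2ℚ ^ℚ D * 1ℚ
      ≤⟨ *-monoˡ-≤ (2ℚ ^ℚ D) (^-0≤ 0≤2 D) (*-mono-≤ (ℚ.<⇒≤ 0<1) 0≤q 1≤q 1≤) ⟩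
    2ℚ ^ℚ D * (q * (2ℚ ^ℚ ℓ * π))
      ≡⟨ solve 4 (λ a q b π → a :* (q :* (b :* π)) := (a :* b) :* (q :* π)) refl (2ℚ ^ℚ D) q (2ℚ ^ℚ ℓ) π ⟩
    2ℚ ^ℚ D * 2ℚ ^ℚ ℓ * (q * π)
      ≡⟨ cong (_* (q * π)) (×-homo-+ ℚ.*-1-monoid 2ℚ D ℓ) ⟨
    2ℚ ^ℚ (D ℕ.+ ℓ) * (q * π)
      ≤⟨ *-monoʳ-≤ (q * π) (*-0≤ 0≤q (ℚ.<⇒≤ 0<π)) (^-mono-≤ 0≤2 (proj₂ (^-unbounded 0<δ 2ℚ)) (D ℕ.+ ℓ)) ⟩
    (ρ ^ℚ M) ^ℚ (D ℕ.+ ℓ) * (q * π)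
      ≡⟨ cong₂ (λ x y → x * (q * y)) (^-^ ρ M (D ℕ.+ ℓ)) (solve 2 (λ T π → π := T :- (T :- π)) refl T π) ⟩
    ρ ^ℚ steps ℓ * (q * (T - (T - π))) ∎
    where
    open ℚ.≤-Reasoning
    T-π≤T : T - π ≤ T
    T-π≤T = ≤-by-difference π (ℚ.<⇒≤ 0<π) (solve 2 (λ T π → T :- π :+ π := T) refl T π)
    0≤T = ℚ.≤-trans (ℚ.<⇒≤ 0<T-π) T-π≤T
    0≤T⁺+q = +-0≤ (ℚ.≤-trans 0≤T T≤T⁺) 0≤q

  bound : List ℕ
  bound = (1 ℕ.+ 2 ℕ.* k ℕ.+ 2 ℕ.* (M ℕ.* D) ℕ.* k) ∷ 2 ℕ.* M ℕ.* k ∷ []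

  bound-size : ∀ ℓ {m s} → m ℕ.≤ suc (steps ℓ) ℕ.* k → 2 ℕ.+ s ℕ.≤ 3 ℕ.+ 2 ℕ.* m → s ℕ.≤ ⟦ bound ⟧ ℓ
  bound-size ℓ {m} {s} m≤ size≤ = ℕ.+-cancelˡ-≤ 2 s (⟦ bound ⟧ ℓ) (begin
    2 ℕ.+ s
      ≤⟨ size≤ ⟩
    3 ℕ.+ 2 ℕ.* m
      ≤⟨ ℕ.+-monoʳ-≤ 3 (ℕ.*-monoʳ-≤ 2 m≤) ⟩
    3 ℕ.+ 2 ℕ.* (suc (M ℕ.* (D ℕ.+ ℓ)) ℕ.* k)
      ≡⟨ ℕ-solve 4 (λ M D ℓ k →
           ℕ-con 3 ⊕ ℕ-con 2 ⊗ ((ℕ-con 1 ⊕ M ⊗ (D ⊕ ℓ)) ⊗ k) ⊜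
           ℕ-con 2 ⊕ (ℕ-con 1 ⊕ ℕ-con 2 ⊗ k ⊕ ℕ-con 2 ⊗ (M ⊗ D) ⊗ k ⊕ ℓ ⊗ (ℕ-con 2 ⊗ M ⊗ k ⊕ ℓ ⊗ ℕ-con 0))) refl M D ℓ k ⟩
    2 ℕ.+ ⟦ bound ⟧ ℓ ∎)
    where
    open ℕ.≤-Reasoning

  approximate : ∀ {αs} → α ∈ αs → Approximable q αs T⁺ bound
  approximate {αs} α∈αs T π π<T T≤T⁺ =
    let w , ≤w , w≤ , m , m≤ , rw = search (steps ℓ) (T - π) T (0<difference π<T) T-π≤T
          (initially-wide T π ℓ (0<difference π<T) T≤T⁺ 0<π (1≤2^⌈log₂1/⌉* π))
        Υ , ŵ , all-α , impl , size≤ = realise q α (ℚ.<⇒≢ 0<q ∘ sym) rw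
    in  Υ , ŵ , w , (λ e → subst (_∈ αs) (sym (all-α e)) α∈αs) , impl , ≤w , w≤ , bound-size ℓ m≤ size≤
    where
    ℓ : ℕ
    ℓ = ⌈log₂1/ π ⌉
    0<π : 0ℚ < π
    0<π = ℚ.positive⁻¹ π
    T-π≤T : T - π ≤ T
    T-π≤T = ≤-by-difference π (ℚ.<⇒≤ 0<π) (solve 2 (λ T π → T :- π :+ π := T) refl T π)

approximable : ∀ {q α αs} → 1ℚ ≤ q → ¬ (- 2ℚ ≤ α × α ≤ 0ℚ) → α ∈ αs → ∀ T⁺ → ∃[ p ] Approximable q αs T⁺ p
approximable {q} {α} {αs} 1≤q α∉ α∈αs T⁺ = from-bundle (large-bundle α∉ (q * q))
  where
  from-bundle : ∃[ w₀ ] q * q ≤ w₀ × ∃[ k ] Realisable q α k w₀ → ∃[ p ] Approximable q αs T⁺ p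
  from-bundle (w₀ , q²≤w₀ , k , r) = bound r 1≤q q²≤w₀ T⁺ , approximate r 1≤q q²≤w₀ T⁺ α∈αs

-- Imported only here, since +_ would make sections such as (x +_) ambiguous.
open import Data.Integer.Base using (+_; -[1+_])

lemma10 : ∀ (q α₁ α₂ α₃ : ℚ) →
    + 5 / 1 < q →
    ¬ (-[1+ 1 ] / 1 ≤ α₁ × α₁ ≤ 0ℚ) →
    -[1+ 1 ] / 1 < α₂ → α₂ < 0ℚ →
    α₃ < -[1+ 0 ] / 1 →
    ∀ (T⁻ T⁺ : ℚ) → 0ℚ < T⁻ → T⁻ ≤ T⁺ →
    Σ[ p ∈ List ℕ ] Σ[ π₀ ∈ ℚ ] 0ℚ < π₀ ×
    (∀ (T* π : ℚ) .{{_ : Positive π}} → T⁻ ≤ T* → T* ≤ T⁺ → π < π₀ →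
    Σ[ Υ ∈ TwoTerminalPlanarGraph ] Σ[ ŵ ∈ (TwoTerminalPlanarGraph.E Υ → ℚ) ] Σ[ w* ∈ ℚ ]
    (∀ e → ŵ e ∈ α₁ ∷ α₂ ∷ α₃ ∷ []) ×
    Implements q Υ ŵ w* ×
    T* - π ≤ w* × w* ≤ T* ×
    TwoTerminalPlanarGraph.size Υ ℕ.≤ ⟦ p ⟧ ⌈log₂1/ π ⌉)
lemma10 q α₁ α₂ α₃ 5<q α₁∉ _ _ _ T⁻ T⁺ 0<T⁻ _ =
  map₂ (λ approximate → T⁻ , 0<T⁻ , λ T* π T⁻≤T* T*≤T⁺ π<T⁻ → approximate T* π (ℚ.<-≤-trans π<T⁻ T⁻≤T*) T*≤T⁺)
       (approximable {q} 1≤q α₁∉ (here refl) T⁺)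
  where
  1≤q : 1ℚ ≤ q
  1≤q = ℚ.≤-trans (ℚ.≤ᵇ⇒≤ _) (ℚ.<⇒≤ 5<q)
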